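{- The Deadline-Driven/Greedy Hybrid algorithm achieves the exactly optimal worst-case backlog of $2$ for both the bamboo garden trimming problem and the fixed-rate cup game. It also achieves backlog less than $H(n)+2$ in the variable-rate cup game on $n$ cups, where $H(n)=\sum_{i=1}^n 1/i$, which is within $1$ of the exact optimal worst-case backlog.
   Context: All games are played on $n$ initially empty cups with nonnegative real heights, in discrete time steps; in each step the adversary adds nonnegative amounts of water summing to $1$, and then the player selects one cup. - Variable-rate cup game: the adversary distributes the $1$ unit of water arbitrarily (adaptively) in each step; the player removes up to $1$ unit from the selected cup (height $h$ becomes $\max(h-1,0)$). - Fixed-rate cup game: the adversary fixes rates $r_1,\dots,r_n\ge 0$, $\sum_i r_i=1$, at the start, and cup $i$ receives $r_i$ in every step; the player removes up to $1$ unit from the selected cup (height $h$ becomes $\max(h-1,0)$). - Bamboo garden trimming problem: the adversary fixes rates $r_1,\dots,r_n\ge 0$, $\sum_i r_i=1$, at the start, and cup $i$ receives $r_i$ in every step; the player empties the selected cup entirely (height becomes $0$). The player observes all heights exactly. The backlog is the supremum over all time steps of the height of the fullest cup, measured after the adversary's move and before the player's move; "achieves backlog less than $B$" means the fullest cup's height is less than $B$ at all time steps, against every adversary. The worst-case backlog of an algorithm is the supremum of its backlog over all adversary strategies/instances, and the optimal worst-case backlog is the smallest worst-case backlog over all algorithms. The paper takes as known from prior work that the optimal worst-case backlog is $2$ for the bamboo garden trimming problem and the fixed-rate cup game (over all instances), and $H(n)+1$ for the variable-rate cup game on $n$ cups. Greedy algorithm: select a fullest cup. Deadline-Driven Strategy: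 among the cups of height at least $1$, select the one that would soonest reach height $2$ if left unselected and growing at its (constant) fill rate; if no cup has height at least $1$, no cup need be selected. Deadline-Driven/Greedy Hybrid: in every step $t$, after the adversary's move, if the maximum cup height is less than $2$, make the move of the Deadline-Driven Strategy, assuming the fill rates are constant (in the variable-rate game the rates used are merely assumed, e.g. the amounts added in the current step); otherwise make the move of the greedy algorithm.
   Formalization: "Within 1 of the exact optimal" is stated for the hybrid's backlog, not for the bound H(n)+2: the optimum here is H(n-1)+1 (for n=1 it is 1, not H(1)+1=2), so H(n)+2 exceeds it by 1+1/n. Heights lie in any Archimedean ordered field with decidable order (classically ℝ). -}

module Defs where

open import Algebra.Bundles using (CommutativeRing)
open import Algebra.Structures using (IsCommutativeRing)
import Algebra.Construct.NaturalChoice.Max as Max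
import Algebra.Definitions.RawMonoid as RawMonoid
open import Data.Fin.Base using (Fin; toℕ)
open import Data.List.Base using (List; []; _∷_)
open import Data.Maybe.Base using (Maybe; just; nothing)
open import Data.Nat.Base using (ℕ; zero; suc)
open import Data.Product.Base using (_×_; _,_; Σ-syntax; ∃-syntax)
open import Data.Vec.Functional using (Vector; updateAt)
open import Function.Base using (const)
open import Level using (Level; _⊔_)
open import Relation.Binary.Bundles using (DecTotalOrder)
import Relation.Binary.Construct.NonStrictToStrict as NonStrictToStrict
open import Relation.Binary.Core using (Rel)
open import Relation.Binary.PropositionalEquality.Core using (_≡_)
open import Relation.Binary.Structures using (IsDecTotalOrder)
open import Relation.Nullary.Negation.Core using (¬_)

private
  variable
    a i : Level

-- The games are played over an arbitrary Archimedean ordered field with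
-- decidable order.  Classically ℝ is such a field (and every such field embeds
-- in it); ℚ is one constructively.  Players compare heights, hence the
-- decidability.

record ArchimedeanOrderedField c ℓ₁ ℓ₂ : Set (Level.suc (c ⊔ ℓ₁ ⊔ ℓ₂)) where
  infix  4 _≈_ _≤_
  infixl 6 _+_
  infixl 7 _*_
  infix  8 -_
  infix  9 _⁻¹

  field
    Carrier           : Set c
    _≈_               : Rel Carrier ℓ₁
    _≤_               : Rel Carrier ℓ₂
    _+_ _*_           : Carrier → Carrier → Carrier
    -_                : Carrier → Carrier
    0# 1#             : Carrier
    -- Total; the value at 0# is unspecified.
    _⁻¹               : Carrier → Carrier
    isCommutativeRing : IsCommutativeRing _≈_ _+_ _*_ -_ 0# 1#
    isDecTotalOrder   : IsDecTotalOrder _≈_ _≤_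
    0≉1               : ¬ 0# ≈ 1#
    ⁻¹-cong           : ∀ {x y} → x ≈ y → x ⁻¹ ≈ y ⁻¹
    ⁻¹-inverse        : ∀ x → ¬ x ≈ 0# → x * x ⁻¹ ≈ 1#
    +-monoˡ-≤         : ∀ z {x y} → x ≤ y → x + z ≤ y + z
    *-nonNegative     : ∀ {x y} → 0# ≤ x → 0# ≤ y → 0# ≤ x * y

  commutativeRing : CommutativeRing c ℓ₁
  commutativeRing = record { isCommutativeRing = isCommutativeRing }

  decTotalOrder : DecTotalOrder c ℓ₁ ℓ₂
  decTotalOrder = record { isDecTotalOrder = isDecTotalOrder }

  open NonStrictToStrict _≈_ _≤_ public using (_<_)
  open Max (DecTotalOrder.totalOrder decTotalOrder) public
    using () renaming (_⊔_ to max)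
  open RawMonoid (CommutativeRing.+-rawMonoid commutativeRing) public
    using (sum) renaming (_×_ to infixr 8 _·_)

  field
    archimedean : ∀ x → ∃[ n ] x ≤ n · 1#

module CupGames {c ℓ₁ ℓ₂} (F : ArchimedeanOrderedField c ℓ₁ ℓ₂) where
  open ArchimedeanOrderedField F

  2# : Carrier
  2# = 1# + 1#

  H : ℕ → Carrier
  H n = sum {n} λ k → (suc (toℕ k) · 1#) ⁻¹

  record Rates (n : ℕ) : Set (c ⊔ ℓ₁ ⊔ ℓ₂) where
    field
      rate        : Vector Carrier n
      nonNegative : ∀ k → 0# ≤ rate k
      total       : sum rate ≈ 1#

  open Rates public

  Heights : ℕ → Set c
  Heights = Vector Carrier

  Move : ℕ → Set
  Move n = Maybe (Fin n)

  -- The heights between the adversary's and the player's move, and the player's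
  -- move.
  Round : ℕ → Set c
  Round n = Heights n × Move n

  -- Histories are listed latest round first.
  Player : ℕ → Set c
  Player n = List (Round n) → Heights n → Move n

  Adversary : ℕ → Set (c ⊔ ℓ₁ ⊔ ℓ₂)
  Adversary n = List (Round n) → Rates n

  -- What a move does to the height of the selected cup.
  Removal : Set c
  Removal = Carrier → Carrier

  removeUnit : Removal
  removeUnit h = max (h + - 1#) 0#

  removeAll : Removal
  removeAll _ = 0#

  module Play {n} (remove : Removal) (A : Player n) (S : Adversary n) where

    after : List (Round n) → Heights n
    after []                  = λ _ → 0#
    after ((h , nothing) ∷ _) = h
    after ((h , just k)  ∷ _) = updateAt h k remove

    filled : List (Round n) → Heights n
    filled rs k = after rs k + rate (S rs) k

    history : ℕ → List (Round n)
    history zero    = []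
    history (suc t) = let rs = history t; h = filled rs in (h , A rs h) ∷ rs

    heights : ℕ → Heights n
    heights t = filled (history t)

    move : ℕ → Move n
    move t = A (history t) (heights t)

  GreedyMove : ∀ {n} → Heights n → Move n → Set ℓ₂
  GreedyMove h m = ∃[ k ] m ≡ just k × (∀ j → h j ≤ h k)

  ReachesTwoIn : ∀ {n} → ℕ → Rates n → Heights n → Fin n → Set ℓ₂
  ReachesTwoIn s r h k = 2# ≤ h k + s · rate r k

  -- Time is counted in steps.  This accepts at least the selections that
  -- minimise the real-valued time (2 - h k) / rate r k.
  ReachesTwoNoLater : ∀ {n} → Rates n → Heights n → Fin n → Fin n → Set ℓ₂
  ReachesTwoNoLater r h k j = ∀ s → ReachesTwoIn s r h j → ReachesTwoIn s r h k

  -- Any move, including none, is allowed when all heights are below 1.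
  DeadlineMove : ∀ {n} → Rates n → Heights n → Move n → Set ℓ₂
  DeadlineMove r h m =
    (∃[ j ] 1# ≤ h j) →
    ∃[ k ] m ≡ just k × 1# ≤ h k × (∀ j → 1# ≤ h j → ReachesTwoNoLater r h k j)

  HybridMove : ∀ {n} → Rates n → Heights n → Move n → Set (ℓ₁ ⊔ ℓ₂)
  HybridMove r h m =
      ((∀ k → h k < 2#) → DeadlineMove r h m)
    × (¬ (∀ k → h k < 2#) → GreedyMove h m)

  IsUpperBound : {I : Set i} → (I → Carrier) → Carrier → Set (i ⊔ ℓ₂)
  IsUpperBound f b = ∀ x → f x ≤ b

  IsSupremum : {I : Set i} → (I → Carrier) → Carrier → Set (c ⊔ i ⊔ ℓ₂)
  IsSupremum f b = IsUpperBound f b × (∀ b′ → IsUpperBound f b′ → b ≤ b′)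

  -- A setting maps each algorithm to the family of all heights (over instances,
  -- steps and cups) occurring before its moves.  The supremum of this family is
  -- the worst-case backlog: the suprema over steps and over adversaries are
  -- taken at once.
  --
  -- Minimality is stated against all upper bounds, so that it also covers
  -- algorithms whose worst-case backlog is not an element of the field.
  IsOptimalWorstCaseBacklog : {Alg : Set a} {I : Set i} →
                              (Alg → I → Carrier) → Carrier → Set (a ⊔ c ⊔ i ⊔ ℓ₂)
  IsOptimalWorstCaseBacklog {Alg = Alg} f b =
      (Σ[ A ∈ Alg ] IsSupremum (f A) b)
    × (∀ A b′ → IsUpperBound (f A) b′ → b ≤ b′)

  -- Constant rates, for any number of cups.  The algorithm learns the rates by
  -- observing the first heights.
  module Constant (remove : Removal) where

    Algorithm : Set c
    Algorithm = ∀ n → Player n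

    module At (A : Algorithm) {n} (r : Rates n) = Play remove (A n) (const r)

    heights : Algorithm → (Σ[ n ∈ ℕ ] Rates n × ℕ × Fin n) → Carrier
    heights A (n , r , t , k) = At.heights A r t k

    IsHybrid : Algorithm → Set (c ⊔ ℓ₁ ⊔ ℓ₂)
    IsHybrid A = ∀ {n} (r : Rates n) t →
                 HybridMove r (At.heights A r t) (At.move A r t)

  module BambooGarden = Constant removeAll
  module FixedRate    = Constant removeUnit

  module VariableRate (n : ℕ) where

    module At (A : Player n) (S : Adversary n) = Play removeUnit A S

    heights : Player n → (Adversary n × ℕ × Fin n) → Carrier
    heights A (S , t , k) = At.heights A S t k

    -- The rates the player assumes, from what it has observed.
    Assumption : Set (c ⊔ ℓ₁ ⊔ ℓ₂)
    Assumption = List (Round n) → Heights n → Rates n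

    IsHybrid : Assumption → Player n → Set (c ⊔ ℓ₁ ⊔ ℓ₂)
    IsHybrid assumed A = ∀ (S : Adversary n) t →
      HybridMove (assumed (At.history A S t) (At.heights A S t))
                 (At.heights A S t) (At.move A S t)

{-# OPTIONS --safe #-}

-- Constant rates: while all heights are below 2 the hybrid is an earliest
-- deadline first scheduler.  Every unit that has to leave a cup before the cup
-- reaches 2 is a job, the rates bound the number of jobs by the number of steps,
-- and so no deadline is missed.  Conversely, with rates 1 − ε and ε either the
-- first cup is skipped once and reaches 2 − 2ε, or the second one grows for ever.
--
-- Variable rates: the average height of any k of the n cups after a move is
-- controlled by downward induction on k.  If the player takes a unit from a
-- fullest cup and that cup is not among the k, then adding it to them does not
-- decrease the average, and k + 1 cups are bounded already; this costs 1/(k + 1).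
-- Otherwise all heights are below 1 (greedy) or 2 (hybrid) anyway.  The adversary
-- meets the greedy bound by filling all cups to nearly 1 and then spreading its
-- water evenly over ever fewer cups that the player has not selected since.
-- So the optimum on n cups, measured before the player's move and with empty
-- initial cups, is 1 + H (n − 1).
module Submission where

open import Algebra.Bundles using (CommutativeMonoid; CommutativeRing)
import Algebra.Construct.NaturalChoice.Max as Max
import Algebra.Properties.CommutativeMonoid.Sum as CommutativeMonoidSum
import Algebra.Properties.Ring as RingProperties
import Algebra.Properties.Semiring.Mult as SemiringMult
import Algebra.Properties.Semiring.Sum as SemiringSum
import Algebra.Solver.Ring.NaturalCoefficients.Default as NaturalCoefficients
open import Data.Bool.Base using (Bool; true; false; if_then_else_)
import Data.Bool.Properties as Bool
open import Data.Empty using (⊥-elim)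
open import Data.Fin.Base using (Fin; zero; suc; toℕ; punchIn)
open import Data.Fin.Properties using (any?; punchInᵢ≢i; toℕ-inject₁; toℕ-fromℕ) renaming (_≟_ to _≟ᶠ_)
open import Data.List.Base using (List; []; _∷_; length)
open import Data.Maybe.Base using (just; nothing; fromMaybe)
open import Data.Maybe.Properties using (just-injective)
open import Data.Nat.Base as ℕ using (ℕ; zero; suc; NonZero)
import Data.Nat.Properties as ℕₚ
open import Data.Product.Base using (_×_; _,_; proj₁; proj₂; ∃-syntax)
open import Data.Sum.Base using (_⊎_; inj₁; inj₂; [_,_]′)
open import Data.Unit.Base using (tt)
open import Data.Vec.Functional using (Vector; updateAt)
open import Data.Vec.Functional.Properties using (updateAt-updates; updateAt-minimal)
open import Function.Base using (_∘_; case_of_; const; id)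
import Level
open import Relation.Binary.Bundles using (DecTotalOrder)
open import Relation.Binary.PropositionalEquality.Core as ≡ using (_≡_; _≢_)
import Relation.Binary.Reasoning.PartialOrder as PartialOrderReasoning
open import Relation.Nullary using (¬_; Dec; yes; no)
open import Relation.Unary using (Pred; Decidable)
open import Defs

-- Sums that differ in one entry.

module SumReplace {c ℓ} (M : CommutativeMonoid c ℓ) where
  open CommutativeMonoid M
  open CommutativeMonoidSum M using (sum; sum-remove; sum-cong-≋)
  open import Relation.Binary.Reasoning.Setoid setoid
  open import Algebra.Properties.CommutativeSemigroup commutativeSemigroup
    using (xy∙z≈zy∙x)

  -- Both sides consist of the common entries off `k` together with `f k` and `g k`. Without
  -- subtraction it serves the counting of jobs in ℕ as well as heights in the field.
  sum-replace : ∀ {n} (f g : Vector Carrier n) k →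
                (∀ j → j ≢ k → f j ≈ g j) → sum f ∙ g k ≈ sum g ∙ f k
  sum-replace {suc n} f g k f≈g = begin
    sum f ∙ g k                       ≈⟨ ∙-congʳ (sum-remove f) ⟩
    (f k ∙ sum (f ∘ punchIn k)) ∙ g k ≈⟨ xy∙z≈zy∙x _ _ _ ⟩
    (g k ∙ sum (f ∘ punchIn k)) ∙ f k ≈⟨ ∙-congʳ (∙-congˡ (sum-cong-≋ λ j → f≈g _ (punchInᵢ≢i k j))) ⟩
    (g k ∙ sum (g ∘ punchIn k)) ∙ f k ≈⟨ ∙-congʳ (sum-remove g) ⟨
    sum g ∙ f k                       ∎

-- Arithmetic of ordered fields and harmonic sums.

module FieldProperties {c ℓ₁ ℓ₂} (F : ArchimedeanOrderedField c ℓ₁ ℓ₂) where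
  open ArchimedeanOrderedField F
  open CupGames F using (H)
  open CommutativeRing commutativeRing public
    using (refl; sym; trans; reflexive; +-cong; +-congˡ; +-congʳ; *-congˡ; *-congʳ;
           +-assoc; +-comm; +-identityˡ; +-identityʳ; *-identityˡ; *-identityʳ; *-comm; zeroˡ; zeroʳ; distribˡ;
           -‿inverseʳ; -‿inverseˡ; ring; semiring; commutativeSemiring; +-commutativeMonoid)
  open DecTotalOrder decTotalOrder public
    using (poset; _≤?_; ≤-respˡ-≈; ≤-respʳ-≈; antisym)
    renaming (refl to ≤-refl; trans to ≤-trans; total to ≤-total; reflexive to ≤-reflexive)
  open SemiringMult semiring public
    using (×-homo-+; ×-assoc-*; ×-congʳ)
  open SemiringSum semiring public
    using (sum-cong-≋; sum-replicate; sum-init-last; *-distribˡ-sum; ∑-distrib-+)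
  open SumReplace +-commutativeMonoid public
  module Solver = NaturalCoefficients commutativeSemiring
  open Solver using (solve; _:+_; _:*_; _:=_; con)
  open PartialOrderReasoning poset using (begin_; step-≤; step-≈-⟩; step-≈-⟨; step-≡-⟩; step-≡-⟨; _∎)

  +-monoʳ-≤ : ∀ z {x y} → x ≤ y → z + x ≤ z + y
  +-monoʳ-≤ z {x} {y} x≤y = begin
    z + x ≈⟨ +-comm z x ⟩
    x + z ≤⟨ +-monoˡ-≤ z x≤y ⟩
    y + z ≈⟨ +-comm y z ⟩
    z + y ∎

  +-mono-≤ : ∀ {x y u v} → x ≤ y → u ≤ v → x + u ≤ y + v
  +-mono-≤ {y = y} {u = u} x≤y u≤v = ≤-trans (+-monoˡ-≤ u x≤y) (+-monoʳ-≤ y u≤v)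

  +-cancelʳ-≤ : ∀ z {x y} → x + z ≤ y + z → x ≤ y
  +-cancelʳ-≤ z {x} {y} x+z≤y+z = begin
    x               ≈⟨ undo x ⟨
    (x + z) + (- z) ≤⟨ +-monoˡ-≤ (- z) x+z≤y+z ⟩
    (y + z) + (- z) ≈⟨ undo y ⟩
    y               ∎
    where
    undo : ∀ w → (w + z) + (- z) ≈ w
    undo w = trans (+-assoc w z (- z))
                   (trans (+-congˡ (-‿inverseʳ z)) (+-identityʳ w))

  -- Linear arithmetic: add up the hypotheses to x ≤ y and leave a semiring
  -- identity to the solver.
  transfer : ∀ {x y a b} → x ≤ y → a + y ≈ b + x → a ≤ b
  transfer {x} {y} {a} {b} x≤y eq = +-cancelʳ-≤ x (begin
    a + x ≤⟨ +-monoʳ-≤ a x≤y ⟩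
    a + y ≈⟨ eq ⟩
    b + x ∎)

  ≰⇒≥ : ∀ {x y} → ¬ x ≤ y → y ≤ x
  ≰⇒≥ {x} {y} x≰y = [ (λ x≤y → ⊥-elim (x≰y x≤y)) , id ]′ (≤-total x y)

  ≰⇒< : ∀ {x y} → ¬ x ≤ y → y < x
  ≰⇒< x≰y = ≰⇒≥ x≰y , λ y≈x → x≰y (≤-reflexive (sym y≈x))

  <⇒≱ : ∀ {x y} → x < y → ¬ y ≤ x
  <⇒≱ (x≤y , x≉y) y≤x = x≉y (antisym x≤y y≤x)

  ≤-<-trans : ∀ {x y z} → x ≤ y → y < z → x < z
  ≤-<-trans x≤y y<z = ≰⇒< λ z≤x → <⇒≱ y<z (≤-trans z≤x x≤y)

  <-≤-trans : ∀ {x y z} → x < y → y ≤ z → x < z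
  <-≤-trans x<y y≤z = ≰⇒< λ z≤x → <⇒≱ x<y (≤-trans y≤z z≤x)

  +-mono-<-≤ : ∀ {x y u v} → x < y → u ≤ v → x + u < y + v
  +-mono-<-≤ {x} {y} {u} {v} x<y u≤v = ≰⇒< λ y+v≤x+u →
    <⇒≱ x<y (transfer (+-mono-≤ y+v≤x+u u≤v)
      (solve 4 (λ x y u v → y :+ (x :+ u :+ v) := x :+ (y :+ v :+ u)) refl x y u v))

  ∃-difference : ∀ {x y} → x ≤ y → ∃[ d ] 0# ≤ d × x + d ≈ y
  ∃-difference {x} {y} x≤y = y + - x , 0≤d , x+d≈y
    where
    x+d≈y : x + (y + - x) ≈ y
    x+d≈y = trans (solve 3 (λ x y z → x :+ (y :+ z) := y :+ (x :+ z)) refl x y (- x))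
                  (trans (+-congˡ (-‿inverseʳ x)) (+-identityʳ y))
    0≤d : 0# ≤ y + - x
    0≤d = transfer x≤y (trans (+-identityˡ y)
      (trans (sym x+d≈y) (+-comm x _)))

  *-monoˡ-≤ : ∀ z {x y} → 0# ≤ z → x ≤ y → z * x ≤ z * y
  *-monoˡ-≤ z {x} {y} 0≤z x≤y with ∃-difference x≤y
  ... | d , 0≤d , x+d≈y = begin
    z * x         ≈⟨ +-identityʳ _ ⟨
    z * x + 0#    ≤⟨ +-monoʳ-≤ _ (*-nonNegative 0≤z 0≤d) ⟩
    z * x + z * d ≈⟨ distribˡ z x d ⟨
    z * (x + d)   ≈⟨ *-congˡ x+d≈y ⟩
    z * y         ∎

  -- In an ordered ring squares are nonnegative: if `1# ≤ 0#`, then -1 is nonnegative, and so is its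
  -- square 1.
  0≤1 : 0# ≤ 1#
  0≤1 with ≤-total 0# 1#
  ... | inj₁ 0≤1′ = 0≤1′
  ... | inj₂ 1≤0 with ∃-difference 1≤0
  ...   | d , 0≤d , 1+d≈0 = ≤-respʳ-≈ d*d≈1 (*-nonNegative 0≤d 0≤d)
    where
    -- d = −1
    d*d≈1 : d * d ≈ 1#
    d*d≈1 = trans (sym (+-identityˡ _)) (trans (+-congʳ (sym 1+d≈0))
      (trans (solve 1 (λ d → (con 1 :+ d) :+ d :* d := con 1 :+ d :* (con 1 :+ d)) refl d)
      (trans (+-congˡ (trans (*-congˡ 1+d≈0) (zeroʳ d))) (+-identityʳ 1#))))

  0<1 : 0# < 1#
  0<1 = 0≤1 , 0≉1

  1≰0 : ¬ 1# ≤ 0#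
  1≰0 = <⇒≱ 0<1

  x≤x+y : ∀ {x y} → 0# ≤ y → x ≤ x + y
  x≤x+y {x} {y} 0≤y = ≤-respˡ-≈ (+-identityʳ x) (+-monoʳ-≤ x 0≤y)

  +-nonNegative : ∀ {x y} → 0# ≤ x → 0# ≤ y → 0# ≤ x + y
  +-nonNegative 0≤x 0≤y = ≤-trans 0≤x (x≤x+y 0≤y)

  ⁻¹-nonNegative : ∀ {x} → 0# < x → 0# ≤ x ⁻¹
  ⁻¹-nonNegative {x} (0≤x , 0≉x) with ≤-total 0# (x ⁻¹)
  ... | inj₁ 0≤x⁻¹ = 0≤x⁻¹
  ... | inj₂ x⁻¹≤0 = ⊥-elim (1≰0 (begin
    1#       ≈⟨ ⁻¹-inverse x (0≉x ∘ sym) ⟨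
    x * x ⁻¹ ≤⟨ *-monoˡ-≤ x 0≤x x⁻¹≤0 ⟩
    x * 0#   ≈⟨ zeroʳ x ⟩
    0#       ∎))

  x⁻¹*[x*y]≈y : ∀ {x} y → 0# < x → x ⁻¹ * (x * y) ≈ y
  x⁻¹*[x*y]≈y {x} y (_ , 0≉x) =
    trans (solve 3 (λ x i y → i :* (x :* y) := (x :* i) :* y) refl x (x ⁻¹) y)
          (trans (*-congʳ (⁻¹-inverse x (0≉x ∘ sym))) (*-identityˡ y))

  *-cancelˡ-≤ : ∀ {z x y} → 0# < z → z * x ≤ z * y → x ≤ y
  *-cancelˡ-≤ {z} {x} {y} 0<z zx≤zy = begin
    x              ≈⟨ x⁻¹*[x*y]≈y x 0<z ⟨
    z ⁻¹ * (z * x) ≤⟨ *-monoˡ-≤ (z ⁻¹) (⁻¹-nonNegative 0<z) zx≤zy ⟩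
    z ⁻¹ * (z * y) ≈⟨ x⁻¹*[x*y]≈y y 0<z ⟩
    y              ∎

  ·≈1·* : ∀ n x → n · x ≈ n · 1# * x
  ·≈1·* n x = trans (×-congʳ n (sym (*-identityˡ x))) (sym (×-assoc-* n 1# x))

  ·-nonNegative : ∀ n {x} → 0# ≤ x → 0# ≤ n · x
  ·-nonNegative zero    0≤x = ≤-refl
  ·-nonNegative (suc n) 0≤x = +-nonNegative 0≤x (·-nonNegative n 0≤x)

  ·-monoˡ-≤ : ∀ {m n x} → 0# ≤ x → m ℕ.≤ n → m · x ≤ n · x
  ·-monoˡ-≤ {n = n} 0≤x ℕ.z≤n = ·-nonNegative n 0≤x
  ·-monoˡ-≤ {x = x} 0≤x (ℕ.s≤s m≤n) = +-monoʳ-≤ x (·-monoˡ-≤ 0≤x m≤n)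

  0<suc·1 : ∀ n → 0# < suc n · 1#
  0<suc·1 n = <-≤-trans 0<1 (x≤x+y (·-nonNegative n 0≤1))

  ·1-cancel-< : ∀ {m n} → m · 1# < n · 1# → m ℕ.< n
  ·1-cancel-< m<n = ℕₚ.≰⇒> λ n≤m → <⇒≱ m<n (·-monoˡ-≤ 0≤1 n≤m)

  1/suc : ℕ → Carrier
  1/suc n = (suc n · 1#) ⁻¹

  0≤1/suc : ∀ n → 0# ≤ 1/suc n
  0≤1/suc n = ⁻¹-nonNegative (0<suc·1 n)

  suc·1/suc : ∀ n → suc n · 1/suc n ≈ 1#
  suc·1/suc n = trans (·≈1·* (suc n) (1/suc n)) (⁻¹-inverse _ (proj₂ (0<suc·1 n) ∘ sym))

  -- The only use of the Archimedean axiom.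
  ≤-limit : ∀ m {x y} → (∀ T → x ≤ y + m · 1/suc (m ℕ.+ T)) → x ≤ y
  ≤-limit m {x} {y} x≤y+ with x ≤? y
  ... | yes x≤y = x≤y
  ... | no  x≰y with ∃-difference (≰⇒≥ x≰y)
  ...   | g , 0≤g , y+g≈x with archimedean (g ⁻¹ * suc m · 1#)
  -- If `x` exceeds `y` by `g` > 0, then `T` ≥ (m + 1)/g gives g · (1 + m + T) ≥ m + 1, while the
  -- hypothesis at `T` gives g · (1 + m + T) ≤ m.
  ...     | T , m/g≤T = ⊥-elim (1≰0 (transfer sm≤m (sym (+-identityˡ _))))
    where
    N = suc (m ℕ.+ T)
    g≉0 : ¬ 0# ≈ g
    g≉0 0≈g = x≰y (≤-reflexive (trans (sym y+g≈x) (trans (+-congˡ (sym 0≈g)) (+-identityʳ y))))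
    g≤m/N : g ≤ m · 1/suc (m ℕ.+ T)
    g≤m/N = transfer (x≤y+ T)
      (trans (solve 3 (λ g y z → g :+ (y :+ z) := z :+ (y :+ g)) refl g y _) (+-congˡ y+g≈x))
    sm≤m : suc m · 1# ≤ m · 1#
    sm≤m = begin
      suc m · 1#                            ≈⟨ x⁻¹*[x*y]≈y _ (0≤g , g≉0) ⟨
      g ⁻¹ * (g * suc m · 1#)               ≈⟨ solve 3 (λ i g s → i :* (g :* s) := g :* (i :* s)) refl _ _ _ ⟩
      g * (g ⁻¹ * suc m · 1#)               ≤⟨ *-monoˡ-≤ g 0≤g m/g≤T ⟩
      g * T · 1#                            ≤⟨ *-monoˡ-≤ g 0≤g (·-monoˡ-≤ 0≤1 (ℕₚ.m≤n⇒m≤1+n (ℕₚ.m≤n+m T m))) ⟩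
      g * N · 1#                            ≈⟨ *-comm _ _ ⟩
      N · 1# * g                            ≤⟨ *-monoˡ-≤ _ (proj₁ (0<suc·1 (m ℕ.+ T))) g≤m/N ⟩
      N · 1# * (m · 1/suc (m ℕ.+ T))        ≈⟨ *-congˡ (·≈1·* m _) ⟩
      N · 1# * (m · 1# * 1/suc (m ℕ.+ T))   ≈⟨ solve 3 (λ n m i → n :* (m :* i) := m :* (n :* i)) refl _ _ _ ⟩
      m · 1# * (N · 1# * 1/suc (m ℕ.+ T))   ≈⟨ *-congˡ (sym (·≈1·* N _)) ⟩
      m · 1# * (N · 1/suc (m ℕ.+ T))        ≈⟨ *-congˡ (suc·1/suc (m ℕ.+ T)) ⟩
      m · 1# * 1#                           ≈⟨ *-identityʳ _ ⟩
      m · 1#                                ∎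

  sum-mono-≤ : ∀ {n} {f g : Vector Carrier n} → (∀ i → f i ≤ g i) → sum f ≤ sum g
  sum-mono-≤ {zero}  f≤g = ≤-refl
  sum-mono-≤ {suc n} f≤g = +-mono-≤ (f≤g zero) (sum-mono-≤ (f≤g ∘ suc))

  sum-nonNegative : ∀ {n} {f : Vector Carrier n} → (∀ i → 0# ≤ f i) → 0# ≤ sum f
  sum-nonNegative {zero}  0≤f = ≤-refl
  sum-nonNegative {suc n} 0≤f = +-nonNegative (0≤f zero) (sum-nonNegative (0≤f ∘ suc))

  ≤-sum : ∀ {n} {f : Vector Carrier n} → (∀ i → 0# ≤ f i) → ∀ i → f i ≤ sum f
  ≤-sum 0≤f zero    = x≤x+y (sum-nonNegative (0≤f ∘ suc))
  ≤-sum 0≤f (suc i) = ≤-trans (≤-sum (0≤f ∘ suc) i)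
    (≤-respˡ-≈ (+-identityˡ _) (+-monoˡ-≤ _ (0≤f zero)))

  sum-· : ∀ n {m} (f : Vector Carrier m) → sum (λ i → n · f i) ≈ n · sum f
  sum-· n {m} f = trans (sum-cong-≋ {m} λ i → ·≈1·* n (f i))
    (trans (sym (*-distribˡ-sum (n · 1#) f)) (sym (·≈1·* n (sum f))))

  H-suc : ∀ n → H (suc n) ≈ H n + 1/suc n
  H-suc n = trans (sum-init-last {n} (1/suc ∘ toℕ))
    (+-cong (sum-cong-≋ {n} λ k → reflexive (≡.cong 1/suc (toℕ-inject₁ k)))
            (reflexive (≡.cong 1/suc (toℕ-fromℕ n))))

  H-mono-≤ : ∀ {m n} → m ℕ.≤ n → H m ≤ H n
  H-mono-≤ {m} m≤n = go (ℕₚ.≤⇒≤′ m≤n)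
    where
    go : ∀ {n} → m ℕ.≤′ n → H m ≤ H n
    go ℕ.≤′-refl           = ≤-refl
    go (ℕ.≤′-step {n} m≤n) = ≤-trans (go m≤n) (≤-respʳ-≈ (sym (H-suc n)) (x≤x+y (0≤1/suc n)))

  data Argmax {n p} (P : Pred (Fin n) p) (score : Vector Carrier n) : Set (p Level.⊔ ℓ₂) where
    none : (∀ j → ¬ P j) → Argmax P score
    best : ∀ k → P k → (∀ j → P j → score j ≤ score k) → Argmax P score

  argmax : ∀ {n p} {P : Pred (Fin n) p} → Decidable P → ∀ score → Argmax P score
  argmax {zero}  P? score = none λ ()
  argmax {suc n} P? score with argmax (P? ∘ suc) (score ∘ suc) | P? zero
  ... | none ¬P | no ¬P₀ = none λ { zero → ¬P₀ ; (suc j) → ¬P j }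
  ... | none ¬P | yes P₀ = best zero P₀ λ { zero _ → ≤-refl ; (suc j) Pj → ⊥-elim (¬P j Pj) }
  ... | best k Pk max | no ¬P₀ = best (suc k) Pk λ { zero P₀ → ⊥-elim (¬P₀ P₀) ; (suc j) → max j }
  ... | best k Pk max | yes P₀ with ≤-total (score zero) (score (suc k))
  ...   | inj₁ 0≤k = best (suc k) Pk λ { zero _ → 0≤k ; (suc j) → max j }
  ...   | inj₂ k≤0 = best zero P₀ λ { zero _ → ≤-refl ; (suc j) Pj → ≤-trans (max j Pj) k≤0 }

open CommutativeMonoidSum ℕₚ.+-0-commutativeMonoid using () renaming (sum to sumℕ)
open SumReplace ℕₚ.+-0-commutativeMonoid using () renaming (sum-replace to sumℕ-replace)

sumℕ-updateAt-suc : ∀ {n} (d : Vector ℕ n) k → sumℕ (updateAt d k suc) ≡ suc (sumℕ d)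
sumℕ-updateAt-suc d k = ℕₚ.+-cancelʳ-≡ (d k) _ _ (≡.trans
  (sumℕ-replace (updateAt d k suc) d k λ j j≢k → updateAt-minimal j k d j≢k)
  (≡.trans (≡.cong (sumℕ d ℕ.+_) (updateAt-updates k d)) (ℕₚ.+-suc (sumℕ d) (d k))))

-- Removals and single rounds of play.

module Cups {c ℓ₁ ℓ₂} (F : ArchimedeanOrderedField c ℓ₁ ℓ₂) where
  open ArchimedeanOrderedField F
  open CupGames F
  open FieldProperties F
  open Solver using (solve; _:+_; _:*_; _:=_; con)
  open PartialOrderReasoning poset using (begin_; step-≤; step-≈-⟩; step-≈-⟨; step-≡-⟩; step-≡-⟨; _∎)

  -- What taking a unit and emptying a cup have in common. The argument for constant rates is
  -- carried out once, for every such removal.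
  record IsRemoval (remove : Removal) : Set (c Level.⊔ ℓ₂) where
    field
      remove-nonNegative : ∀ {h} → 0# ≤ h → 0# ≤ remove h
      remove-≤           : ∀ {h} → 0# ≤ h → remove h ≤ h
      remove-unit        : ∀ {h} → 1# ≤ h → remove h + 1# ≤ h

  removeAll-isRemoval : IsRemoval removeAll
  removeAll-isRemoval = record
    { remove-nonNegative = λ _ → ≤-refl
    ; remove-≤           = id
    ; remove-unit        = ≤-respˡ-≈ (sym (+-identityˡ 1#))
    }

  private
    [h-1]+1≈h : ∀ h → (h + - 1#) + 1# ≈ h
    [h-1]+1≈h h = trans (+-assoc h (- 1#) 1#)
                        (trans (+-congˡ (-‿inverseˡ 1#)) (+-identityʳ h))

    open Max (DecTotalOrder.totalOrder decTotalOrder) using (x≤y⇒x⊔y≈y; x≤y⇒y⊔x≈y)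

  -- Stated additively, since the solver handles semiring identities only.
  removeUnit-≥1 : ∀ {h} → 1# ≤ h → removeUnit h + 1# ≈ h
  removeUnit-≥1 {h} 1≤h = trans (+-congʳ (x≤y⇒y⊔x≈y 0≤h-1)) ([h-1]+1≈h h)
    where
    0≤h-1 : 0# ≤ h + - 1#
    0≤h-1 = +-cancelʳ-≤ 1# (≤-respʳ-≈ (sym ([h-1]+1≈h h)) (≤-respˡ-≈ (sym (+-identityˡ 1#)) 1≤h))

  removeUnit-≤1 : ∀ {h} → h ≤ 1# → removeUnit h ≈ 0#
  removeUnit-≤1 {h} h≤1 = x≤y⇒x⊔y≈y
    (+-cancelʳ-≤ 1# (≤-respˡ-≈ (sym ([h-1]+1≈h h)) (≤-respʳ-≈ (sym (+-identityˡ 1#)) h≤1)))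

  removeUnit-isRemoval : IsRemoval removeUnit
  removeUnit-isRemoval = record
    { remove-nonNegative = nonNeg
    ; remove-≤           = decr
    ; remove-unit        = ≤-reflexive ∘ removeUnit-≥1
    }
    where
    nonNeg : ∀ {h} → 0# ≤ h → 0# ≤ removeUnit h
    nonNeg {h} _ with ≤-total h 1#
    ... | inj₁ h≤1 = ≤-reflexive (sym (removeUnit-≤1 h≤1))
    ... | inj₂ 1≤h = transfer 1≤h (trans (+-identityˡ h) (sym (removeUnit-≥1 1≤h)))
    decr : ∀ {h} → 0# ≤ h → removeUnit h ≤ h
    decr {h} 0≤h with ≤-total h 1#
    ... | inj₁ h≤1 = ≤-respˡ-≈ (sym (removeUnit-≤1 h≤1)) 0≤h
    ... | inj₂ 1≤h = ≤-trans (x≤x+y 0≤1) (≤-reflexive (removeUnit-≥1 1≤h))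

  -- A move detached from its history, so that invariants can be proved for a single round;
  -- `after-∷` connects it with `after`.
  played : ∀ {n} → Removal → Move n → Heights n → Heights n
  played remove nothing  h = h
  played remove (just k) h = updateAt h k remove

  played-other : ∀ {n} (remove : Removal) (m : Move n) h {i} → m ≢ just i → played remove m h i ≡ h i
  played-other remove nothing  h m≢i = ≡.refl
  played-other remove (just k) h {i} m≢i = updateAt-minimal i k h (m≢i ∘ ≡.cong just ∘ ≡.sym)

  module _ {remove : Removal} (isRemoval : IsRemoval remove) where
    open IsRemoval isRemoval

    played-nonNegative : ∀ {n} (m : Move n) {h} → (∀ i → 0# ≤ h i) → ∀ i → 0# ≤ played remove m h i
    played-nonNegative nothing  0≤h i = 0≤h i
    played-nonNegative (just k) {h} 0≤h i with i ≟ᶠ k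
    ... | yes ≡.refl = ≤-respʳ-≈ (reflexive (≡.sym (updateAt-updates k h))) (remove-nonNegative (0≤h k))
    ... | no  i≢k    = ≤-respʳ-≈ (reflexive (≡.sym (updateAt-minimal i k h i≢k))) (0≤h i)

    played-≤ : ∀ {n} (m : Move n) {h} → (∀ i → 0# ≤ h i) → ∀ i → played remove m h i ≤ h i
    played-≤ nothing  0≤h i = ≤-refl
    played-≤ (just k) {h} 0≤h i with i ≟ᶠ k
    ... | yes ≡.refl = ≤-respˡ-≈ (reflexive (≡.sym (updateAt-updates k h))) (remove-≤ (0≤h k))
    ... | no  i≢k    = ≤-reflexive (reflexive (updateAt-minimal i k h i≢k))

  module PlayProperties {n} (remove : Removal) (A : Player n) (S : Adversary n) where
    open Play remove A S

    after-∷ : ∀ h m rs i → after ((h , m) ∷ rs) i ≡ played remove m h i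
    after-∷ h nothing  rs i = ≡.refl
    after-∷ h (just k) rs i = ≡.refl

    heights-suc : ∀ t i → heights (suc t) i ≡
                  played remove (move t) (heights t) i + rate (S (history (suc t))) i
    heights-suc t i = ≡.cong (_+ rate (S (history (suc t))) i) (after-∷ (heights t) (move t) (history t) i)

    module _ (isRemoval : IsRemoval remove) where

      after-nonNegative : ∀ t i → 0# ≤ after (history t) i
      after-nonNegative zero    i = ≤-refl
      after-nonNegative (suc t) i =
        ≤-respʳ-≈ (reflexive (≡.sym (after-∷ (heights t) (move t) (history t) i)))
          (played-nonNegative isRemoval (move t)
            (λ j → +-nonNegative (after-nonNegative t j) (Rates.nonNegative (S (history t)) j)) i)

      rate≤heights : ∀ t i → rate (S (history t)) i ≤ heights t i
      rate≤heights t i = ≤-respˡ-≈ (+-identityˡ _) (+-monoˡ-≤ _ (after-nonNegative t i))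

      heights-nonNegative : ∀ t i → 0# ≤ heights t i
      heights-nonNegative t i = ≤-trans (Rates.nonNegative (S (history t)) i) (rate≤heights t i)

  -- Earliest deadline first scheduling.

  -- The deadline of a cup of height at least 1 is the step in which it would
  -- reach 2.  If d i units of cup i fall due within s steps, i.e. have to be
  -- removed from it in order to keep it below 2, then all of these together
  -- must fit into s moves.
  module _ {n} (r : Rates n) where

    -- After `d i` - 1 removals the cup would still reach 2, so the level to compare with is `d i` +
    -- 1. This makes sense for positive `d i` only; `Schedulable` therefore lets a cup claim nothing
    -- by a separate alternative.
    Due : Heights n → ℕ → Vector ℕ n → Fin n → Set ℓ₂
    Due h s d i = suc (d i) · 1# ≤ h i + s · rate r i

    Schedulable : Heights n → Set ℓ₂
    Schedulable h = ∀ s d → (∀ i → d i ≡ 0 ⊎ Due h s d i) → sumℕ d ℕ.≤ s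

    -- In a cup that is already at 2, one unit is due within zero steps, but zero moves cannot serve
    -- it.
    Schedulable⇒<2 : ∀ {h} → Schedulable h → ∀ k → h k < 2#
    Schedulable⇒<2 {h} sch k = ≰⇒< λ 2≤hk →
      ℕₚ.1+n≰n (ℕₚ.≤-trans (ℕₚ.≤-reflexive (≡.sym (sumℕ-updateAt-suc (const 0) k)))
        (ℕₚ.≤-trans (sch 0 (updateAt (const 0) k suc) (due 2≤hk)) ℕ.z≤n))
      where
      due : 2# ≤ h k → ∀ i → updateAt (const 0) k suc i ≡ 0 ⊎ Due h 0 (updateAt (const 0) k suc) i
      due 2≤hk i with i ≟ᶠ k
      ... | no  i≢k    = inj₁ (updateAt-minimal i k (const 0) i≢k)
      ... | yes ≡.refl rewrite updateAt-updates k {suc} (const 0) = inj₂ (begin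
        1# + (1# + 0#) ≈⟨ +-congˡ (+-identityʳ 1#) ⟩
        2#             ≤⟨ 2≤hk ⟩
        h k            ≈⟨ +-identityʳ (h k) ⟨
        h k + 0#       ∎)

    private
      -- One strict summand makes the whole inequality strict; if there is none, all entries of `d`
      -- vanish.
      sumℕ<sum : ∀ {n} (d : Vector ℕ n) (w : Vector Carrier n) → (∀ i → 0# ≤ w i) →
                 (∀ i → d i ≡ 0 ⊎ d i · 1# < w i) → sumℕ d ≡ 0 ⊎ sumℕ d · 1# < sum w
      sumℕ<sum {zero}  d w 0≤w d<w = inj₁ ≡.refl
      sumℕ<sum {suc n} d w 0≤w d<w
        with d zero | d<w zero | sumℕ<sum (d ∘ suc) (w ∘ suc) (0≤w ∘ suc) (d<w ∘ suc)
      ... | .0 | inj₁ ≡.refl | inj₁ eq = inj₁ eq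
      ... | .0 | inj₁ ≡.refl | inj₂ lt =
        inj₂ (<-≤-trans lt (≤-respˡ-≈ (+-identityˡ _) (+-monoˡ-≤ _ (0≤w zero))))
      ... | d₀ | inj₂ lt     | inj₁ eq rewrite eq | ℕₚ.+-identityʳ d₀ =
        inj₂ (<-≤-trans lt (x≤x+y (sum-nonNegative (0≤w ∘ suc))))
      ... | d₀ | inj₂ lt     | inj₂ (le , _) =
        inj₂ (≤-<-trans (≤-reflexive (×-homo-+ 1# d₀ _)) (+-mono-<-≤ lt le))

    -- A cup below 1 can owe its claims only to inflow, so `d i` is strictly less than its inflow in
    -- s + 1 steps. The inflows add up to s + 1, and strictness between integers saves the one move.
    sumℕ-due≤ : ∀ {h} s d → (∀ i → d i ≡ 0 ⊎ (h i < 1# × Due h (suc s) d i)) → sumℕ d ℕ.≤ s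
    sumℕ-due≤ {h} s d due with sumℕ<sum d (λ i → suc s · rate r i)
        (λ i → ·-nonNegative (suc s) (Rates.nonNegative r i)) below
      where
      below : ∀ i → d i ≡ 0 ⊎ d i · 1# < suc s · rate r i
      below i with due i
      ... | inj₁ eq = inj₁ eq
      ... | inj₂ (hi<1 , le) = inj₂ (≰⇒< λ sr≤d → <⇒≱ hi<1 (transfer (+-mono-≤ le sr≤d)
        (solve 4 (λ d h o w → o :+ (h :+ w :+ d) := h :+ ((o :+ d) :+ w)) refl (d i · 1#) (h i) 1# _)))
    ... | inj₁ eq = ℕₚ.≤-trans (ℕₚ.≤-reflexive eq) ℕ.z≤n
    ... | inj₂ lt = ℕ.s≤s⁻¹ (·1-cancel-< {n = suc s} (<-≤-trans lt (≤-reflexive Σsr≈s)))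
      where
      Σsr≈s : sum (λ i → suc s · rate r i) ≈ suc s · 1#
      Σsr≈s = trans (sum-· (suc s) (rate r)) (×-congʳ (suc s) (Rates.total r))

    module _ {remove : Removal} (isRemoval : IsRemoval remove) where
      open IsRemoval isRemoval using (remove-unit)

      -- A move spent on a cup that falls due is counted in d; if no selected
      -- cup falls due within s + 1 steps, then only cups of height less than 1
      -- do, and their claims are bounded by the inflow of these steps.
      deadline-step : ∀ {h m} → (∀ i → 0# ≤ h i) → DeadlineMove r h m → Schedulable h →
                      Schedulable (λ i → played remove m h i + rate r i)
      deadline-step {h} {m} 0≤h deadline sch s d due with any? (λ j → 1# ≤? h j)
      -- The deadline rule leaves the move open here, but every claim belongs to a cup below 1.
      ... | no  h≱1 = sumℕ-due≤ s d λ i → [ inj₁ , (λ le → inj₂ (≰⇒< (λ 1≤hi → h≱1 (i , 1≤hi)) , earlier i le)) ]′ (due i)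
        where
        earlier : ∀ i → Due (λ i → played remove m h i + rate r i) s d i → Due h (suc s) d i
        earlier i le = begin
          suc (d i) · 1#                              ≤⟨ le ⟩
          played remove m h i + rate r i + s · rate r i ≈⟨ +-assoc _ _ _ ⟩
          played remove m h i + suc s · rate r i      ≤⟨ +-monoˡ-≤ _ (played-≤ isRemoval m 0≤h i) ⟩
          h i + suc s · rate r i                      ∎
      ... | yes h≥1 with deadline h≥1
      ...   | k , ≡.refl , 1≤hk , soonest with 2# ≤? h k + suc s · rate r k
      -- The unit removed now is one more claim on `k` within s + 1 steps. The enlarged claims fit
      -- into s + 1 moves by hypothesis, hence the claims `d` into s.
      ...     | yes 2≤ = ℕ.s≤s⁻¹ (ℕₚ.≤-trans (ℕₚ.≤-reflexive (≡.sym (sumℕ-updateAt-suc d k)))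
                           (sch (suc s) (updateAt d k suc) due⁺))
        where
        due⁺ : ∀ i → updateAt d k suc i ≡ 0 ⊎ Due h (suc s) (updateAt d k suc) i
        due⁺ i with i ≟ᶠ k | due i
        ... | no  i≢k    | due-i rewrite updateAt-minimal i k {suc} d i≢k
                                       | updateAt-minimal i k {remove} h i≢k =
          [ inj₁ , (λ le → inj₂ (≤-trans le (≤-reflexive (+-assoc _ _ _)))) ]′ due-i
        ... | yes ≡.refl | due-k rewrite updateAt-updates k {suc} d
                                       | updateAt-updates k {remove} h =
          inj₂ ([ none-left , some-left ]′ due-k)
          where
          -- If `d` claims nothing from `k`, the added claim is due because `k` would reach 2 in
          -- time.
          none-left : d k ≡ 0 → suc (suc (d k)) · 1# ≤ h k + suc s · rate r k
          none-left eq rewrite eq = ≤-respˡ-≈ (+-congˡ (sym (+-identityʳ 1#))) 2≤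
          some-left : suc (d k) · 1# ≤ remove (h k) + rate r k + s · rate r k →
                      suc (suc (d k)) · 1# ≤ h k + suc s · rate r k
          some-left le = transfer (+-mono-≤ le (remove-unit 1≤hk))
            (solve 6 (λ o d g r t h → (o :+ (o :+ d)) :+ (g :+ r :+ t :+ h) := (h :+ (r :+ t)) :+ ((o :+ d) :+ (g :+ o)))
              refl 1# (d k · 1#) (remove (h k)) (rate r k) (s · rate r k) (h k))
      ...     | no  2≰ = sumℕ-due≤ s d λ i → late i (due i)
        where
        late : ∀ i → d i ≡ 0 ⊎ Due (λ i → played remove (just k) h i + rate r i) s d i →
               d i ≡ 0 ⊎ (h i < 1# × Due h (suc s) d i)
        late i (inj₁ eq) = inj₁ eq
        late i (inj₂ le) with d i | le
        ... | zero  | _   = inj₁ ≡.refl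
        -- A cup with a claim would reach 2 within s + 1 steps. Were its height at least 1,
        -- `soonest` would make `k` reach 2 as well.
        ... | suc e | le′ = inj₂ (≰⇒< (λ 1≤hi → 2≰ (soonest i 1≤hi (suc s) 2≤)) , le″)
          where
          le″ : suc (suc e) · 1# ≤ h i + suc s · rate r i
          le″ = begin
            suc (suc e) · 1#                              ≤⟨ le′ ⟩
            played remove (just k) h i + rate r i + s · rate r i ≈⟨ +-assoc _ _ _ ⟩
            played remove (just k) h i + suc s · rate r i ≤⟨ +-monoˡ-≤ _ (played-≤ isRemoval (just k) 0≤h i) ⟩
            h i + suc s · rate r i                        ∎
          2≤ : 2# ≤ h i + suc s · rate r i
          2≤ = ≤-trans (+-monoʳ-≤ 1# (x≤x+y (·-nonNegative e 0≤1))) le″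

  selection : ∀ {n p} {P : Fin n → Set p} {score} → Argmax P score → Move n
  selection (none _)     = nothing
  selection (best k _ _) = just k

  -- Optimal backlog for constant rates.

  module ConstantRates {remove : Removal} (isRemoval : IsRemoval remove) where
    open Constant remove using (Algorithm; IsHybrid) renaming (heights to allHeights)

    module _ {n} (A : Player n) (r : Rates n) where
      open Play remove A (const r)
      open PlayProperties remove A (const r)

      -- The invariant sustains itself: `Schedulable` keeps the heights below 2, this entitles to a
      -- deadline move, and that move preserves `Schedulable`.
      deadline⇒<2 : (∀ t → (∀ k → heights t k < 2#) → DeadlineMove r (heights t) (move t)) →
                    ∀ t k → heights t k < 2#
      deadline⇒<2 deadline t = Schedulable⇒<2 r (schedulable t)
        where
        schedulable : ∀ t → Schedulable r (heights t)
        -- The first heights are one inflow into empty cups, so the claims are those of cups of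
        -- height 0 within s + 1 steps.
        schedulable zero s d due = sumℕ-due≤ r {h = λ _ → 0#} s d
          λ i → [ inj₁ , (λ le → inj₂ (0<1 , ≤-respʳ-≈ (+-assoc _ _ _) le)) ]′ (due i)
        schedulable (suc t) s d due = deadline-step r isRemoval {h = heights t} {m = move t}
          (heights-nonNegative isRemoval t)
          (deadline t (Schedulable⇒<2 r (schedulable t))) (schedulable t) s d
          λ i → [ inj₁ , (λ le → inj₂ (≤-respʳ-≈ (+-congʳ (reflexive (heights-suc t i))) le)) ]′ (due i)

    -- With ε = 1 / (3 + T), the rate of cup 0 is 1 − ε.
    twoCups : ℕ → Rates 2
    twoCups T = record
      { rate        = λ { zero → (2 ℕ.+ T) · ε ; (suc _) → ε }
      ; nonNegative = λ { zero → ·-nonNegative (2 ℕ.+ T) 0≤ε ; (suc _) → 0≤ε }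
      ; total       = trans (solve 2 (λ e k → k :+ (e :+ con 0) := e :+ k) refl ε ((2 ℕ.+ T) · ε))
                            (suc·1/suc (2 ℕ.+ T))
      }
      where
      ε = 1/suc (2 ℕ.+ T)
      0≤ε = 0≤1/suc (2 ℕ.+ T)

    2≤bound : ∀ A b → IsUpperBound (allHeights A) b → 2# ≤ b
    2≤bound A b h≤b = ≤-limit 2 λ T → go T
      where
      module _ (T : ℕ) where
        N = 3 ℕ.+ T
        ε = 1/suc (2 ℕ.+ T)
        0≤ε = 0≤1/suc (2 ℕ.+ T)
        open Play remove (A 2) (const (twoCups T))
        open PlayProperties remove (A 2) (const (twoCups T))

        -- Before the move cup 0 holds at least one inflow 1 - ε; left alone, it receives another
        -- and stands at 2 - 2ε or more.
        skipped : ∀ t → move t ≢ just zero → 2# ≤ b + 2 · ε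
        skipped t m≢0 = begin
          1# + 1#                             ≈⟨ +-cong (suc·1/suc (2 ℕ.+ T)) (suc·1/suc (2 ℕ.+ T)) ⟨
          (ε + k) + (ε + k)                   ≈⟨ solve 2 (λ e k → (e :+ k) :+ (e :+ k) := (k :+ k) :+ (e :+ (e :+ con 0))) refl ε k ⟩
          (k + k) + 2 · ε                     ≤⟨ +-monoˡ-≤ _ (+-monoˡ-≤ k (rate≤heights isRemoval t zero)) ⟩
          (heights t zero + k) + 2 · ε        ≡⟨ ≡.cong (λ x → x + k + 2 · ε) (played-other remove (move t) (heights t) m≢0) ⟨
          (played remove (move t) (heights t) zero + k) + 2 · ε ≡⟨ ≡.cong (_+ 2 · ε) (heights-suc t zero) ⟨
          heights (suc t) zero + 2 · ε        ≤⟨ +-monoˡ-≤ _ (h≤b (2 , twoCups T , suc t , zero)) ⟩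
          b + 2 · ε                           ∎
          where k = (2 ℕ.+ T) · ε

        grows : ∀ t → 2# ≤ b + 2 · ε ⊎ suc t · ε ≤ heights t (suc zero)
        grows zero = inj₂ (≤-reflexive (trans (+-identityʳ ε) (sym (+-identityˡ ε))))
        grows (suc t) with move t in eq
        ... | nothing         = inj₁ (skipped t λ eq′ → case ≡.trans (≡.sym eq) eq′ of λ ())
        ... | just (suc zero) = inj₁ (skipped t λ eq′ → case ≡.trans (≡.sym eq) eq′ of λ ())
        ... | just zero with grows t
        ...   | inj₁ done = inj₁ done
        ...   | inj₂ le   = inj₂ (≤-respˡ-≈ (+-comm _ ε) (+-monoˡ-≤ ε le))

        go : 2# ≤ b + 2 · ε
        -- Since N · ε = 1, cup 1 reaches 2 after 2N inflows of ε; the successor of the chosen time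
        -- is N + N.
        go with grows (2 ℕ.+ T ℕ.+ N)
        ... | inj₁ done = done
        ... | inj₂ le   = begin
          1# + 1#                                 ≈⟨ +-cong (suc·1/suc (2 ℕ.+ T)) (suc·1/suc (2 ℕ.+ T)) ⟨
          N · ε + N · ε                           ≈⟨ ×-homo-+ ε N N ⟨
          (N ℕ.+ N) · ε                           ≤⟨ le ⟩
          heights (2 ℕ.+ T ℕ.+ N) (suc zero)      ≤⟨ h≤b (2 , twoCups T , 2 ℕ.+ T ℕ.+ N , suc zero) ⟩
          b                                       ≤⟨ x≤x+y (·-nonNegative 2 0≤ε) ⟩
          b + 2 · ε                               ∎

    isSupremum : ∀ A → (∀ {n} (r : Rates n) t k → Play.heights remove (A n) (const r) t k < 2#) →
                 IsSupremum (allHeights A) 2#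
    isSupremum A <2 = (λ (n , r , t , k) → proj₁ (<2 r t k)) , 2≤bound A

    hybrid-isSupremum : ∀ A → IsHybrid A → IsSupremum (allHeights A) 2#
    hybrid-isSupremum A hybrid = isSupremum A λ {n} r → deadline⇒<2 (A n) r λ t → proj₁ (hybrid r t)

    gap : Carrier → Carrier
    gap h = 2# + - h

    h+gap≈2 : ∀ h → h + gap h ≈ 2#
    h+gap≈2 h = trans (solve 3 (λ h t m → h :+ (t :+ m) := t :+ (h :+ m)) refl h 2# (- h))
                      (trans (+-congˡ (-‿inverseʳ h)) (+-identityʳ 2#))

    0<gap : ∀ {h} → h < 2# → 0# < gap h
    0<gap {h} h<2 = ≰⇒< λ gap≤0 → <⇒≱ h<2 (transfer gap≤0
      (trans (+-identityʳ 2#) (sym (h+gap≈2 h))))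

    -- The reciprocal of the real-valued time to reach height 2.
    urgency : ∀ {n} → Vector Carrier n → Heights n → Vector Carrier n
    urgency q h k = q k * gap (h k) ⁻¹

    selectMostUrgent : ∀ {n} → Vector Carrier n → Heights n → Move n
    selectMostUrgent q h = selection (argmax (λ k → 1# ≤? h k) (urgency q h))

    -- A cup reaches 2 in `s` steps exactly if `s` times its urgency is at least 1, so a cup of
    -- greatest urgency is never later than another. The rates `q` are observed ones and agree with
    -- `r` only up to `≈`.
    selectMostUrgent-deadline : ∀ {n} (r : Rates n) q h → (∀ k → q k ≈ rate r k) →
                                (∀ k → h k < 2#) → DeadlineMove r h (selectMostUrgent q h)
    selectMostUrgent-deadline r q h q≈r h<2 (j , 1≤hj) with argmax (λ k → 1# ≤? h k) (urgency q h)
    ... | none h≱1 = ⊥-elim (h≱1 j 1≤hj)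
    ... | best k 1≤hk maximal = k , ≡.refl , 1≤hk , λ j 1≤hj s → reaches j s (maximal j 1≤hj)
      where
      reaches : ∀ j s → urgency q h j ≤ urgency q h k → ReachesTwoIn s r h j → ReachesTwoIn s r h k
      reaches j s uj≤uk 2≤hj+srj = transfer (begin
        gap (h k)                         ≈⟨ *-identityʳ _ ⟨
        gap (h k) * 1#                    ≤⟨ *-monoˡ-≤ _ (proj₁ (0<gap (h<2 k))) 1≤s*uk ⟩
        gap (h k) * (s · 1# * urgency q h k) ≈⟨ inflow k ⟨
        s · rate r k                      ∎)
        (trans (+-congʳ (sym (h+gap≈2 (h k))))
               (solve 3 (λ h g s → (h :+ g) :+ s := (h :+ s) :+ g) refl (h k) (gap (h k)) _))
        where
        inflow : ∀ i → s · rate r i ≈ gap (h i) * (s · 1# * urgency q h i)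
        inflow i = trans (·≈1·* s _) (trans (*-congˡ (trans (sym (q≈r i)) (sym (x⁻¹*[x*y]≈y (q i) (0<gap (h<2 i))))))
          (solve 4 (λ s g g⁻¹ q → s :* (g⁻¹ :* (g :* q)) := g :* (s :* (q :* g⁻¹))) refl (s · 1#) (gap (h i)) (gap (h i) ⁻¹) (q i)))
        gap≤srj : gap (h j) ≤ s · rate r j
        gap≤srj = transfer 2≤hj+srj
          (trans (solve 3 (λ g h s → g :+ (h :+ s) := s :+ (h :+ g)) refl (gap (h j)) (h j) (s · rate r j))
                 (+-congˡ (h+gap≈2 (h j))))
        1≤s*uk : 1# ≤ s · 1# * urgency q h k
        1≤s*uk = ≤-trans
          (*-cancelˡ-≤ (0<gap (h<2 j)) (≤-respˡ-≈ (sym (*-identityʳ _)) (≤-respʳ-≈ (inflow j) gap≤srj)))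
          (*-monoˡ-≤ _ (·-nonNegative s 0≤1) uj≤uk)

    -- The first heights are the rates.
    firstHeights : ∀ {n} → List (Round n) → Heights n → Heights n
    firstHeights []             h = h
    firstHeights ((h′ , _) ∷ rs) h = firstHeights rs h′

    deadlineDriven : Algorithm
    deadlineDriven n rs h = selectMostUrgent (firstHeights rs h) h

    deadlineDriven-isSupremum : IsSupremum (allHeights deadlineDriven) 2#
    deadlineDriven-isSupremum = isSupremum deadlineDriven λ {n} r →
      deadline⇒<2 (deadlineDriven n) r λ t → selectMostUrgent-deadline r _ _ (first≈rate r t)
      where
      first≈rate : ∀ {n} (r : Rates n) t k →
                   let open Play remove (deadlineDriven n) (const r) in
                   firstHeights (history t) (heights t) k ≈ rate r k
      first≈rate r zero    k = +-identityˡ _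
      first≈rate r (suc t) k = first≈rate r t k

    2-isOptimal : IsOptimalWorstCaseBacklog allHeights 2#
    2-isOptimal = (deadlineDriven , deadlineDriven-isSupremum) , 2≤bound

-- Variable rates: sets of cups and the water in them.

module VariableRates {c ℓ₁ ℓ₂} (F : ArchimedeanOrderedField c ℓ₁ ℓ₂) (m : ℕ) where
  open ArchimedeanOrderedField F
  open CupGames F
  open FieldProperties F
  open Cups F
  open RingProperties ring using (+-cancelʳ)
  open Solver using (solve; _:+_; _:*_; _:=_; con)
  open PartialOrderReasoning poset using (begin_; step-≤; step-≈-⟩; step-≈-⟨; step-≡-⟩; step-≡-⟨; _∎)
  open VariableRate (suc m) using (IsHybrid) renaming (heights to allHeights)

  private
    n = suc m

  Subset : Set
  Subset = Vector Bool n

  -- Zeros outside the subset turn a partial sum into an ordinary one, to which the lemmas on `sum`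
  -- apply.
  restrict : Subset → Heights n → Heights n
  restrict p x i = if p i then x i else 0#

  mass : Subset → Heights n → Carrier
  mass p x = sum (restrict p x)

  -- As a field element and a special mass, the size obeys `mass-insert` and `mass-delete` too.
  size : Subset → Carrier
  size p = mass p (const 1#)

  restrict-member : ∀ p x {i} → p i ≡ true → restrict p x i ≡ x i
  restrict-member p x pi rewrite pi = ≡.refl

  restrict-nonmember : ∀ p x {i} → p i ≡ false → restrict p x i ≡ 0#
  restrict-nonmember p x pi rewrite pi = ≡.refl

  mass-mono-≤ : ∀ p {x y} → (∀ i → p i ≡ true → x i ≤ y i) → mass p x ≤ mass p y
  mass-mono-≤ p {x} {y} x≤y = sum-mono-≤ λ i → restricted i
    where
    restricted : ∀ i → restrict p x i ≤ restrict p y i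
    restricted i with p i in eq
    ... | true  = x≤y i eq
    ... | false = ≤-refl

  mass≤sum : ∀ p {x} → (∀ i → 0# ≤ x i) → mass p x ≤ sum x
  mass≤sum p {x} 0≤x = sum-mono-≤ λ i → restricted i
    where
    restricted : ∀ i → restrict p x i ≤ x i
    restricted i with p i
    ... | true  = ≤-refl
    ... | false = 0≤x i

  mass-const : ∀ p y → mass p (const y) ≈ y * size p
  mass-const p y = trans (sum-cong-≋ {n} λ i → restricted i) (sym (*-distribˡ-sum y (restrict p (const 1#))))
    where
    restricted : ∀ i → restrict p (const y) i ≈ y * restrict p (const 1#) i
    restricted i with p i
    ... | true  = sym (*-identityʳ y)
    ... | false = sym (zeroʳ y)

  mass-+ : ∀ p x y → mass p (λ i → x i + y i) ≈ mass p x + mass p y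
  mass-+ p x y = trans (sum-cong-≋ {n} λ i → restricted i) (∑-distrib-+ (restrict p x) (restrict p y))
    where
    restricted : ∀ i → restrict p (λ i → x i + y i) i ≈ restrict p x i + restrict p y i
    restricted i with p i
    ... | true  = refl
    ... | false = sym (+-identityˡ 0#)

  mass-filled : ∀ p x (r : Rates n) → mass p (λ i → x i + rate r i) ≤ mass p x + 1#
  mass-filled p x r = ≤-respˡ-≈ (sym (mass-+ p x (rate r)))
    (+-monoʳ-≤ _ (≤-respʳ-≈ (Rates.total r) (mass≤sum p (Rates.nonNegative r))))

  sum-filled : ∀ x (r : Rates n) → sum (λ i → x i + rate r i) ≈ sum x + 1#
  sum-filled x r = trans (∑-distrib-+ x (rate r)) (+-congˡ (Rates.total r))

  insert : Fin n → Subset → Subset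
  insert k p = updateAt p k (const true)

  delete : Fin n → Subset → Subset
  delete k p = updateAt p k (const false)

  private
    mass-updateAt : ∀ p k b x → mass (updateAt p k (const b)) x + restrict p x k ≈
                    mass p x + (if b then x k else 0#)
    mass-updateAt p k b x =
      trans (sum-replace (restrict (updateAt p k (const b)) x) (restrict p x) k
              λ j j≢k → reflexive (≡.cong (if_then x j else 0#) (updateAt-minimal j k p j≢k)))
            (+-congˡ (reflexive (≡.cong (if_then x k else 0#) (updateAt-updates k p))))

  mass-insert : ∀ {k} p x → p k ≡ false → mass (insert k p) x ≈ mass p x + x k
  mass-insert {k} p x pk = trans (sym (+-identityʳ _))
    (trans (+-congˡ (reflexive (≡.sym (restrict-nonmember p x pk)))) (mass-updateAt p k true x))

  mass-delete : ∀ {k} p x → p k ≡ true → mass (delete k p) x + x k ≈ mass p x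
  mass-delete {k} p x pk = trans (+-congˡ (reflexive (≡.sym (restrict-member p x pk))))
    (trans (mass-updateAt p k false x) (+-identityʳ _))

  mass-removeUnit : ∀ {k h} p → p k ≡ true → 1# ≤ h k → mass p (updateAt h k removeUnit) + 1# ≈ mass p h
  mass-removeUnit {k} {h} p pk 1≤hk = +-cancelʳ (removeUnit (h k)) _ _
    (trans (solve 3 (λ a b c → a :+ b :+ c := a :+ (c :+ b)) refl _ 1# _)
      (trans (+-congˡ (trans (removeUnit-≥1 1≤hk) (reflexive (≡.sym (restrict-member p h pk)))))
        (trans (sum-replace (restrict p h′) (restrict p h) k agree)
          (+-congˡ (reflexive (≡.trans (restrict-member p h′ pk) (updateAt-updates k h)))))))
    where
    h′ = updateAt h k removeUnit
    agree : ∀ j → j ≢ k → restrict p h′ j ≈ restrict p h j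
    agree j j≢k = reflexive (≡.cong (λ y → if p j then y else 0#) (updateAt-minimal j k h j≢k))

  sum-removeUnit : ∀ (h : Heights n) k → 1# ≤ h k → sum (updateAt h k removeUnit) + 1# ≈ sum h
  sum-removeUnit h k = mass-removeUnit {k} {h} (const true) ≡.refl

  -- The invariant on averages.

  -- x are heights after a move.  The player keeps all cups at height at most
  -- 1 + γ, except when it removes a full unit from a fullest cup.
  record Bounded (γ : Carrier) (x : Heights n) : Set (c Level.⊔ ℓ₁ Level.⊔ ℓ₂) where
    field
      -- The case of all n cups, where the downward induction starts.
      total≤  : sum x ≤ m · 1# + γ
      -- The average over any k < n cups is at most 1 + γ + 1/(k+1) + ⋯ + 1/m.
      subset≤ : ∀ k p → k ℕ.≤ m → size p ≈ k · 1# →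
                mass p x + k · 1# * H k ≤ k · 1# * (1# + γ + H m)

  open Bounded

  FullUnitFromFullest : Heights n → Move n → Set ℓ₂
  FullUnitFromFullest h mv = ∃[ k ] mv ≡ just k × 1# ≤ h k × (∀ j → h j ≤ h k)

  -- The two components maintain the two fields of `Bounded`: the first the total, the second the
  -- subset bounds. Greedy moves are sound for γ = 0, hybrid moves for γ = 1.
  Sound : Carrier → Heights n → Move n → Set ℓ₂
  Sound γ h mv = (sum (played removeUnit mv h) + 1# ≤ sum h ⊎ sum (played removeUnit mv h) ≤ m · 1# + γ)
               × ((∀ i → h i ≤ 1# + γ) ⊎ FullUnitFromFullest h mv)

  private
    0≤H : ∀ k → 0# ≤ H k
    0≤H k = sum-nonNegative {k} λ i → 0≤1/suc (toℕ i)

    H1≈1 : H 1 ≈ 1#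
    H1≈1 = suc·1/suc 0

    mass-∅ : ∀ x → mass (const false) x ≈ 0#
    mass-∅ x = trans (mass-const (const true) 0#) (zeroˡ _)

  module _ {γ} (0≤γ : 0# ≤ γ) where

    bounded-empty : Bounded γ (λ _ → 0#)
    bounded-empty = record
      { total≤  = ≤-trans (≤-reflexive (trans (mass-const (const true) 0#) (zeroˡ _)))
                          (+-nonNegative (·-nonNegative m 0≤1) 0≤γ)
      ; subset≤ = λ k p k≤m _ → begin
          mass p (const 0#) + k · 1# * H k ≈⟨ +-congʳ (trans (mass-const p 0#) (zeroˡ _)) ⟩
          0# + k · 1# * H k                ≈⟨ +-identityˡ _ ⟩
          k · 1# * H k                     ≤⟨ *-monoˡ-≤ _ (·-nonNegative k 0≤1) (H-mono-≤ k≤m) ⟩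
          k · 1# * H m                     ≤⟨ *-monoˡ-≤ _ (·-nonNegative k 0≤1)
                                                (≤-respˡ-≈ (+-identityˡ _) (+-monoˡ-≤ _ (+-nonNegative 0≤1 0≤γ))) ⟩
          k · 1# * (1# + γ + H m)          ∎
      }

    bounded-step : ∀ {x} (r : Rates n) mv → (∀ i → 0# ≤ x i) →
                   let h = λ i → x i + rate r i in
                   sum (played removeUnit mv h) ≤ m · 1# + γ →
                   (∀ i → h i ≤ 1# + γ) ⊎ FullUnitFromFullest h mv →
                   Bounded γ x → Bounded γ (played removeUnit mv h)
    bounded-step {x} r mv 0≤x sum≤ mode bx = record { total≤ = sum≤ ; subset≤ = bound mode }
      where
      h : Heights n
      h i = x i + rate r i
      0≤h : ∀ i → 0# ≤ h i
      0≤h i = +-nonNegative (0≤x i) (Rates.nonNegative r i)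

      bound : (∀ i → h i ≤ 1# + γ) ⊎ FullUnitFromFullest h mv →
              ∀ k p → k ℕ.≤ m → size p ≈ k · 1# →
              mass p (played removeUnit mv h) + k · 1# * H k ≤ k · 1# * (1# + γ + H m)
      bound (inj₁ h≤) k p k≤m sz = begin
        mass p (played removeUnit mv h) + K * H k ≤⟨ +-mono-≤ (mass-mono-≤ p λ i _ → ≤-trans (played-≤ removeUnit-isRemoval mv 0≤h i) (h≤ i))
                                                              (*-monoˡ-≤ K (·-nonNegative k 0≤1) (H-mono-≤ k≤m)) ⟩
        mass p (const (1# + γ)) + K * H m         ≈⟨ +-congʳ (trans (mass-const p _) (trans (*-congˡ sz) (*-comm _ K))) ⟩
        K * (1# + γ) + K * H m                    ≈⟨ distribˡ K _ _ ⟨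
        K * (1# + γ + H m)                        ∎
        where K = k · 1#
      bound (inj₂ (top , ≡.refl , 1≤t , h≤t)) k p k≤m sz with p top in ptop
      -- The removed unit comes out of `p` and makes up for the inflow into `p`, which is at most 1.
      ... | true  = transfer (+-mono-≤ (≤-trans (≤-reflexive (mass-removeUnit p ptop 1≤t)) (mass-filled p x r))
                                       (subset≤ bx k p k≤m sz))
        (solve 5 (λ a b c o d → a :+ b :+ (c :+ o :+ d) := d :+ (a :+ o :+ (c :+ b))) refl
           (mass p (played removeUnit mv h)) (k · 1# * H k) (mass p x) 1# (k · 1# * (1# + γ + H m)))
      -- The top height `t` is at least the average M/K, so (1 + K) · M ≤ K · (M + t), and `larger`
      -- bounds M + t.
      ... | false = *-cancelˡ-≤ (0<suc·1 k) (transfer (+-mono-≤ (*-monoˡ-≤ K 0≤K larger) M≤K*t)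
        (solve 5 (λ k M a C t → (con 1 :+ k) :* (M :+ k :* a) :+ (k :* ((con 1 :+ k) :* C) :+ k :* t) :=
                                (con 1 :+ k) :* (k :* C) :+ (k :* (M :+ t :+ (con 1 :+ k) :* a) :+ M))
               refl K M (H k) C (h top)))
        where
        K = k · 1#
        0≤K = ·-nonNegative k 0≤1
        C = 1# + γ + H m
        M = mass p (played removeUnit mv h)
        t = h top
        M≤mass : M ≤ mass p h
        M≤mass = mass-mono-≤ p λ i _ → played-≤ removeUnit-isRemoval mv 0≤h i
        M≤K*t : M ≤ K * t
        M≤K*t = ≤-trans M≤mass (≤-trans (mass-mono-≤ p λ i _ → h≤t i)
          (≤-reflexive (trans (mass-const p t) (trans (*-congˡ sz) (*-comm t K)))))
        p⁺ = insert top p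
        M+t≤mass⁺ : M + t ≤ mass p⁺ h
        M+t≤mass⁺ = ≤-trans (+-monoˡ-≤ t M≤mass) (≤-reflexive (sym (mass-insert p h ptop)))
        larger : M + t + (1# + K) * H k ≤ (1# + K) * C
        larger with ℕₚ.m≤n⇒m<n∨m≡n k≤m
        -- Going from `H (suc k)` to `H k` frees (k + 1) · 1/(k + 1) = 1, which pays for the inflow.
        ... | inj₁ k<m = transfer
          (+-mono-≤ (≤-trans M+t≤mass⁺ (mass-filled p⁺ x r))
                    (≤-respˡ-≈ (+-congˡ [1+K]H) (subset≤ bx (suc k) p⁺ k<m size⁺)))
          (solve 5 (λ s a o mp c → (s :+ a) :+ (mp :+ o :+ c) := c :+ (s :+ (mp :+ (a :+ o)))) refl
            (M + t) ((1# + K) * H k) 1# (mass p⁺ x) ((1# + K) * C))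
          where
          size⁺ : size p⁺ ≈ suc k · 1#
          size⁺ = trans (mass-insert p (const 1#) ptop) (trans (+-congʳ sz) (+-comm K 1#))
          [1+K]H : suc k · 1# * H (suc k) ≈ (1# + K) * H k + 1#
          [1+K]H = trans (*-congˡ (H-suc k)) (trans (distribˡ _ (H k) _)
            (+-congˡ (trans (sym (·≈1·* (suc k) _)) (suc·1/suc k))))
        -- Now `p⁺` has m + 1 = n cups, and `total≤` takes the place of a subset bound.
        ... | inj₂ ≡.refl = transfer (+-mono-≤ M+t≤ (*-nonNegative 0≤K 0≤γ))
          (solve 4 (λ s k g b → (s :+ (con 1 :+ k) :* b) :+ (k :+ g :+ con 1 :+ k :* g) :=
                                  (con 1 :+ k) :* (con 1 :+ g :+ b) :+ (s :+ con 0))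
            refl (M + t) K γ (H k))
          where
          M+t≤ : M + t ≤ K + γ + 1#
          M+t≤ = begin
            M + t       ≤⟨ M+t≤mass⁺ ⟩
            mass p⁺ h   ≤⟨ mass≤sum p⁺ 0≤h ⟩
            sum h       ≈⟨ sum-filled x r ⟩
            sum x + 1#  ≤⟨ +-monoˡ-≤ 1# (total≤ bx) ⟩
            K + γ + 1#  ∎

    -- A single cup is the case k = 1 of `subset≤`, with H 1 = 1. For m = 0 that case is out of
    -- range, and `total≤` bounds the only cup.
    bounded⇒≤ : ∀ {x} → (∀ i → 0# ≤ x i) → Bounded γ x → ∀ i → x i ≤ γ + H m
    bounded⇒≤ {x} 0≤x bx i with m ℕₚ.≟ 0
    ... | yes m≡0 = begin
      x i          ≤⟨ ≤-sum 0≤x i ⟩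
      sum x        ≤⟨ total≤ bx ⟩
      m · 1# + γ   ≈⟨ +-congʳ (reflexive (≡.cong (_· 1#) m≡0)) ⟩
      0# + γ       ≈⟨ +-identityˡ γ ⟩
      γ            ≤⟨ x≤x+y (0≤H m) ⟩
      γ + H m      ∎
    ... | no  m≢0 = transfer (≤-respˡ-≈ (+-cong mass≈ (*-congˡ H1≈1)) (subset≤ bx 1 p (ℕₚ.n≢0⇒n>0 m≢0) size≈))
      (solve 3 (λ x g b → x :+ (con 1 :+ con 0) :* (con 1 :+ g :+ b) := (g :+ b) :+ (x :+ (con 1 :+ con 0) :* con 1))
        refl (x i) γ (H m))
      where
      p = insert i (const false)
      mass≈ : mass p x ≈ x i
      mass≈ = trans (mass-insert {i} (const false) x ≡.refl) (trans (+-congʳ (mass-∅ x)) (+-identityˡ _))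
      size≈ : size p ≈ 1 · 1#
      size≈ = trans (mass-insert {i} (const false) (const 1#) ≡.refl)
        (trans (+-congʳ (mass-∅ (const 1#))) (+-comm 0# 1#))

    module _ (A : Player n) (S : Adversary n) where
      open Play removeUnit A S
      open PlayProperties removeUnit A S

      -- `Bounded` concerns heights after a move; the measured heights come one inflow of at most 1
      -- later.
      sound⇒heights≤ : (∀ t → Sound γ (heights t) (move t)) → ∀ t i → heights t i ≤ 1# + γ + H m
      sound⇒heights≤ sound t i = begin
        heights t i           ≤⟨ +-mono-≤ (bounded⇒≤ (after-nonNegative removeUnit-isRemoval t) (bounded t) i) rate≤1 ⟩
        γ + H m + 1#          ≈⟨ solve 2 (λ g b → g :+ b :+ con 1 := con 1 :+ g :+ b) refl γ (H m) ⟩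
        1# + γ + H m          ∎
        where
        rate≤1 : rate (S (history t)) i ≤ 1#
        rate≤1 = ≤-respʳ-≈ (Rates.total (S (history t))) (≤-sum (Rates.nonNegative (S (history t))) i)
        bounded-∷ : ∀ h mv rs → Bounded γ (played removeUnit mv h) → Bounded γ (after ((h , mv) ∷ rs))
        bounded-∷ h nothing  rs b = b
        bounded-∷ h (just k) rs b = b
        bounded : ∀ t → Bounded γ (after (history t))
        bounded zero    = bounded-empty
        bounded (suc t) with sound t
        ... | sum≤ , mode = bounded-∷ (heights t) (move t) (history t)
          (bounded-step (S (history t)) (move t) (after-nonNegative removeUnit-isRemoval t)
            ([ (λ le → +-cancelʳ-≤ 1# (≤-trans le (≤-trans (≤-reflexive (sum-filled (after (history t)) (S (history t)))) (+-monoˡ-≤ 1# (total≤ (bounded t)))))) , id ]′ sum≤)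
            mode (bounded t))

  -- Greedy and hybrid moves preserve the invariant.

  greedy-sound : ∀ {h mv} → GreedyMove h mv → Sound 0# h mv
  greedy-sound {h} (k , ≡.refl , h≤hk) with 1# ≤? h k
  ... | yes 1≤hk = inj₁ (≤-reflexive (sum-removeUnit h k 1≤hk)) , inj₂ (k , ≡.refl , 1≤hk , h≤hk)
  ... | no  1≰hk = inj₂ sum≤ , inj₁ λ i → ≤-respʳ-≈ (sym (+-identityʳ 1#)) (h≤1 i)
    where
    h≤1 : ∀ i → h i ≤ 1#
    h≤1 i = ≤-trans (h≤hk i) (≰⇒≥ 1≰hk)
    h′ = updateAt h k removeUnit
    -- Cup `k` is emptied. With 1 in its place, all n heights are at most 1, so the actual sum is at
    -- most m.
    filledUp = updateAt h k (const 1#)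
    filledUp≤1 : ∀ i → filledUp i ≤ 1#
    filledUp≤1 i with i ≟ᶠ k
    ... | yes ≡.refl = ≤-reflexive (reflexive (updateAt-updates k h))
    ... | no  i≢k    = ≤-respˡ-≈ (reflexive (≡.sym (updateAt-minimal i k h i≢k))) (h≤1 i)
    sum≤ : sum h′ ≤ m · 1# + 0#
    sum≤ = +-cancelʳ-≤ 1# (begin
      sum h′ + 1#         ≡⟨ ≡.cong (sum h′ +_) (updateAt-updates k h) ⟨
      sum h′ + filledUp k ≈⟨ sum-replace h′ filledUp k (λ j j≢k → reflexive
                               (≡.trans (updateAt-minimal j k h j≢k) (≡.sym (updateAt-minimal j k h j≢k)))) ⟩
      sum filledUp + h′ k ≈⟨ +-congˡ (trans (reflexive (updateAt-updates k h)) (removeUnit-≤1 (h≤1 k))) ⟩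
      sum filledUp + 0#   ≤⟨ +-monoˡ-≤ 0# (sum-mono-≤ filledUp≤1) ⟩
      sum {n} (const 1#) + 0# ≈⟨ +-congʳ (sum-replicate n) ⟩
      n · 1# + 0#         ≈⟨ solve 1 (λ k → con 1 :+ k :+ con 0 := k :+ con 0 :+ con 1) refl (m · 1#) ⟩
      m · 1# + 0# + 1#    ∎)

  -- For γ = 1 the threshold 1 + γ is the height 2 at which the hybrid turns greedy. Below it, a
  -- deadline move takes a full unit if some cup has one, and otherwise the total is at most n = m +
  -- γ.
  hybrid-sound : ∀ {r h mv} → (∀ i → 0# ≤ h i) → HybridMove r h mv → Sound 1# h mv
  hybrid-sound {h = h} {mv} 0≤h (deadline , greedy) with any? (λ k → 2# ≤? h k)
  ... | yes (j , 2≤hj) with greedy (λ h<2 → <⇒≱ (h<2 j) 2≤hj)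
  ...   | k , ≡.refl , h≤hk = inj₁ (≤-reflexive (sum-removeUnit h k 1≤hk)) , inj₂ (k , ≡.refl , 1≤hk , h≤hk)
    where
    1≤hk : 1# ≤ h k
    1≤hk = ≤-trans (x≤x+y 0≤1) (≤-trans 2≤hj (h≤hk j))
  hybrid-sound {h = h} {mv} 0≤h (deadline , greedy) | no h≱2 = sums , inj₁ λ k → proj₁ (h<2 k)
    where
    h<2 : ∀ k → h k < 2#
    h<2 k = ≰⇒< λ 2≤hk → h≱2 (k , 2≤hk)
    sums : sum (played removeUnit mv h) + 1# ≤ sum h ⊎ sum (played removeUnit mv h) ≤ m · 1# + 1#
    sums with any? (λ k → 1# ≤? h k)
    ... | yes h≥1 with deadline h<2 h≥1
    ...   | k , ≡.refl , 1≤hk , _ = inj₁ (≤-reflexive (sum-removeUnit h k 1≤hk))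
    sums | no h≱1 = inj₂ (begin
      sum (played removeUnit mv h) ≤⟨ sum-mono-≤ (λ i → ≤-trans (played-≤ removeUnit-isRemoval mv 0≤h i) (≰⇒≥ λ 1≤hi → h≱1 (i , 1≤hi))) ⟩
      sum {n} (const 1#)           ≈⟨ sum-replicate n ⟩
      1# + m · 1#                  ≈⟨ +-comm 1# _ ⟩
      m · 1# + 1#                  ∎)

  greedy : Player n
  greedy _ h = selection (argmax (λ _ → yes tt) h)

  greedy-move : ∀ rs h → GreedyMove h (greedy rs h)
  greedy-move rs h with argmax (λ _ → yes tt) h
  ... | none empty      = ⊥-elim (empty zero tt)
  ... | best k _ h≤hk = k , ≡.refl , λ j → h≤hk j tt

  greedy≤ : IsUpperBound (allHeights greedy) (H m + 1#)
  greedy≤ (S , t , i) = ≤-respʳ-≈ (solve 1 (λ b → con 1 :+ con 0 :+ b := b :+ con 1) refl (H m))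
    (sound⇒heights≤ ≤-refl greedy S (λ t → greedy-sound {h = heights t} (greedy-move (history t) (heights t))) t i)
    where open Play removeUnit greedy S

  hybrid≤ : ∀ assumed A → IsHybrid assumed A → IsUpperBound (allHeights A) (H m + 1# + 1#)
  hybrid≤ assumed A hybrid (S , t , i) =
    ≤-respʳ-≈ (solve 1 (λ b → con 1 :+ con 1 :+ b := b :+ con 1 :+ con 1) refl (H m))
      (sound⇒heights≤ 0≤1 A S
        (λ t → hybrid-sound {assumed (history t) (heights t)} {heights t} (heights-nonNegative removeUnit-isRemoval t) (hybrid S t)) t i)
    where
    open Play removeUnit A S
    open PlayProperties removeUnit A S

  -- The adversary for variable rates.

  member : ∀ k p → size p ≈ suc k · 1# → ∃[ i ] p i ≡ true
  member k p sz with any? (λ i → p i Bool.≟ true)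
  ... | yes found = found
  ... | no  empty = ⊥-elim (proj₂ (0<suc·1 k) (sym (trans (sym sz) size≈0)))
    where
    size≈0 : size p ≈ 0#
    size≈0 = trans (sum-cong-≋ {n} λ i → reflexive (restrict-nonmember p (const 1#) (Bool.¬-not (λ pi → empty (i , pi)))))
                   (mass-∅ (const 1#))

  ∈-delete : ∀ v p j → delete v p j ≡ true → p j ≡ true × j ≢ v
  ∈-delete v p j p⁻j with j ≟ᶠ v
  ... | no  j≢v    = ≡.trans (≡.sym (updateAt-minimal j v p j≢v)) p⁻j , j≢v
  ... | yes ≡.refl with ≡.trans (≡.sym (updateAt-updates v p)) p⁻j
  ...   | ()

  -- The selected cup if it lies in `p`, and otherwise any member: the set shrinks by exactly one
  -- cup, and the move touches none of those left.
  victim : ∀ {i} mv p → p i ≡ true →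
           ∃[ v ] p v ≡ true × (∀ j → delete v p j ≡ true → p j ≡ true × mv ≢ just j)
  victim {i} nothing  p pi = i , pi , λ j p⁻j → proj₁ (∈-delete i p j p⁻j) , λ ()
  victim {i} (just k) p pi with p k in pk
  ... | true  = k , pk , λ j p⁻j → let pj , j≢k = ∈-delete k p j p⁻j in
    pj , λ k≡j → j≢k (≡.sym (just-injective k≡j))
  ... | false = i , pi , λ j p⁻j → let pj , _ = ∈-delete i p j p⁻j in
    pj , λ k≡j → Bool.not-¬ pj (≡.trans (≡.cong p (≡.sym (just-injective k≡j))) pk)

  spread : ∀ k p → size p ≈ suc k · 1# → Rates n
  spread k p sz = record
    { rate        = restrict p (const (1/suc k))
    ; nonNegative = nonNeg
    ; total       = trans (mass-const p _) (trans (*-congˡ sz) (trans (*-comm _ _)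
                      (trans (sym (·≈1·* (suc k) _)) (suc·1/suc k))))
    }
    where
    nonNeg : ∀ i → 0# ≤ restrict p (const (1/suc k)) i
    nonNeg i with p i
    ... | true  = 0≤1/suc k
    ... | false = ≤-refl

  -- Builds an adaptive adversary round by round: `S` is kept through step `t`, and `r`, used from
  -- then on, may depend on the player's move in that step.
  steer : ℕ → Adversary n → Rates n → Adversary n
  steer t S r rs with length rs ℕₚ.≤? t
  ... | yes _ = S rs
  ... | no  _ = r

  steer-≤ : ∀ {t} S r rs → length rs ℕ.≤ t → steer t S r rs ≡ S rs
  steer-≤ {t} S r rs rs≤t with length rs ℕₚ.≤? t
  ... | yes _    = ≡.refl
  ... | no  rs≰t = ⊥-elim (rs≰t rs≤t)

  steer-> : ∀ {t} S r rs → t ℕ.< length rs → steer t S r rs ≡ r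
  steer-> {t} S r rs t<rs with length rs ℕₚ.≤? t
  ... | yes rs≤t = ⊥-elim (ℕₚ.<⇒≱ t<rs rs≤t)
  ... | no  _    = ≡.refl

  module _ (A : Player n) where

    private
      module At (S : Adversary n) = Play removeUnit A S

    length-history : ∀ S t → length (At.history S t) ≡ t
    length-history S zero    = ≡.refl
    length-history S (suc t) = ≡.cong suc (length-history S t)

    private
      next : Adversary n → List (Round n) → List (Round n)
      next S rs = (At.filled S rs , A rs (At.filled S rs)) ∷ rs

      next-cong : ∀ S S′ rs → S rs ≡ S′ rs → next S rs ≡ next S′ rs
      next-cong S S′ rs = ≡.cong λ r →
        let h = λ k → At.after S rs k + rate r k in (h , A rs h) ∷ rs

    -- The history before step `suc t` is made by the answers to histories of lengths 0 to `t`,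
    -- which `steer` leaves to `S`.
    history-steer : ∀ t S r s → s ℕ.≤ suc t → At.history (steer t S r) s ≡ At.history S s
    history-steer t S r zero    _   = ≡.refl
    history-steer t S r (suc s) s<t = ≡.trans
      (≡.cong (next (steer t S r)) (history-steer t S r s (ℕₚ.<⇒≤ s<t)))
      (next-cong (steer t S r) S (At.history S s)
        (steer-≤ S r _ (ℕₚ.≤-trans (ℕₚ.≤-reflexive (length-history S s)) (ℕ.s≤s⁻¹ s<t))))

    heights-steer : ∀ t S r i → At.heights (steer t S r) (suc t) i ≡
                    played removeUnit (At.move S t) (At.heights S t) i + rate r i
    heights-steer t S r i = ≡.trans
      (≡.cong (λ rs → At.filled (steer t S r) rs i) (history-steer t S r (suc t) ℕₚ.≤-refl))
      (≡.cong₂ _+_ (PlayProperties.after-∷ removeUnit A S (At.heights S t) (At.move S t) (At.history S t) i)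
                   (≡.cong (λ r → rate r i) (steer-> S r (At.history S (suc t))
                     (ℕₚ.≤-reflexive (≡.sym (length-history S (suc t)))))))

    heights-nonNeg : ∀ S t i → 0# ≤ At.heights S t i
    heights-nonNeg S = PlayProperties.heights-nonNegative removeUnit A S removeUnit-isRemoval

    refilled : ∀ S t r {j c} → c ≤ rate r j → c ≤ At.heights (steer t S r) (suc t) j
    refilled S t r {j} {c} c≤r = begin
      c                                                             ≈⟨ +-identityˡ c ⟨
      0# + c                                                        ≤⟨ +-mono-≤ (played-nonNegative removeUnit-isRemoval (At.move S t) (heights-nonNeg S t) j) c≤r ⟩
      played removeUnit (At.move S t) (At.heights S t) j + rate r j ≡⟨ heights-steer t S r j ⟨
      At.heights (steer t S r) (suc t) j                            ∎

    raised : ∀ S t r {j a c} → At.move S t ≢ just j → a ≤ At.heights S t j → c ≤ rate r j →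
             a + c ≤ At.heights (steer t S r) (suc t) j
    raised S t r {j} {a} {c} unmoved a≤h c≤r = begin
      a + c                                                         ≤⟨ +-mono-≤ a≤h c≤r ⟩
      At.heights S t j + rate r j                                   ≡⟨ ≡.cong (_+ rate r j) (played-other removeUnit (At.move S t) (At.heights S t) unmoved) ⟨
      played removeUnit (At.move S t) (At.heights S t) j + rate r j ≡⟨ heights-steer t S r j ⟨
      At.heights (steer t S r) (suc t) j                            ∎

    module _ (T : ℕ) where
      private
        δ = 1/suc (m ℕ.+ T)
        0≤δ : 0# ≤ δ
        0≤δ = 0≤1/suc (m ℕ.+ T)

        nδ+Tδ≈1 : n · δ + T · δ ≈ 1#
        nδ+Tδ≈1 = trans (sym (×-homo-+ δ n T)) (suc·1/suc (m ℕ.+ T))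

      -- The unit is cut into n + T shares δ: one for each cup and T more for `k`.
      flood : Fin n → Rates n
      flood k = record
        { rate        = updateAt (const δ) k (_+ T · δ)
        ; nonNegative = nonNeg
        ; total       = +-cancelʳ δ _ _ (trans
            (sum-replace (updateAt (const δ) k (_+ T · δ)) (const δ) k
              λ j j≢k → reflexive (updateAt-minimal j k (const δ) j≢k))
            (trans (+-cong (sum-replicate n) (reflexive (updateAt-updates k (const δ))))
              (trans (solve 3 (λ a b c → a :+ (b :+ c) := a :+ c :+ b) refl (n · δ) δ (T · δ)) (+-congʳ nδ+Tδ≈1))))
        }
        where
        nonNeg : ∀ i → 0# ≤ updateAt (const δ) k (_+ T · δ) i
        nonNeg i with i ≟ᶠ k
        ... | yes ≡.refl = ≤-respʳ-≈ (reflexive (≡.sym (updateAt-updates k (const δ))))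
                                     (+-nonNegative 0≤δ (·-nonNegative T 0≤δ))
        ... | no  i≢k    = ≤-respʳ-≈ (reflexive (≡.sym (updateAt-minimal i k (const δ) i≢k))) 0≤δ

      rate-flood-self : ∀ k → rate (flood k) k ≈ suc T · δ
      rate-flood-self k = reflexive (updateAt-updates k (const δ))

      δ≤rate-flood : ∀ k i → δ ≤ rate (flood k) i
      δ≤rate-flood k i with i ≟ᶠ k
      ... | yes ≡.refl = ≤-respʳ-≈ (sym (rate-flood-self k)) (x≤x+y (·-nonNegative T 0≤δ))
      ... | no  i≢k    = ≤-reflexive (reflexive (≡.sym (updateAt-minimal i k (const δ) i≢k)))

      private
        flooding-step : ∀ t S k → t ℕ.< T → (∀ i → i ≢ k → At.move S t ≢ just i) →
                        (∀ i → suc t · δ ≤ At.heights S t i) →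
                        ∀ i → suc (suc t) · δ ≤ At.heights (steer t S (flood k)) (suc t) i
        flooding-step t S k t<T unmoved level i = by-cases (i ≟ᶠ k)
          where
          by-cases : Dec (i ≡ k) → suc (suc t) · δ ≤ At.heights (steer t S (flood k)) (suc t) i
          -- However little was left in `k`, its inflow (T + 1) · δ alone attains the new level, as
          -- t < T.
          by-cases (yes ≡.refl) = ≤-trans (·-monoˡ-≤ 0≤δ (ℕ.s≤s t<T))
            (refilled S t (flood k) (≤-reflexive (sym (rate-flood-self k))))
          by-cases (no  i≢k)    = ≤-respˡ-≈ (+-comm (suc t · δ) δ)
            (raised S t (flood k) (unmoved i i≢k) (level i) (δ≤rate-flood k i))

      -- The selected cup is refilled to the common level, and then all levels
      -- rise by δ.
      flooding : ∀ t → t ℕ.≤ T → ∃[ S ] (∀ i → suc t · δ ≤ At.heights S t i)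
      flooding zero    _   = const (flood zero) , λ i →
        ≤-respʳ-≈ (sym (+-identityˡ _)) (≤-respˡ-≈ (sym (+-identityʳ δ)) (δ≤rate-flood zero i))
      flooding (suc t) t<T =
        let S , level = flooding t (ℕₚ.<⇒≤ t<T)
            -- If no cup was selected, any cup may take the surplus shares.
            k         = fromMaybe zero (At.move S t)
        in steer t S (flood k) , flooding-step t S k t<T (λ i i≢k eq → i≢k (≡.sym (≡.cong (fromMaybe zero) eq))) level

    private
      spread-raises : ∀ k S t p a v (sz⁻ : size (delete v p) ≈ suc k · 1#) →
                      (∀ j → delete v p j ≡ true → p j ≡ true × At.move S t ≢ just j) →
                      (∀ i → p i ≡ true → a ≤ At.heights S t i) →
                      ∀ j → delete v p j ≡ true →
                      a + 1/suc k ≤ At.heights (steer t S (spread k (delete v p) sz⁻)) (suc t) j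
      spread-raises k S t p a v sz⁻ survives a≤ j p⁻j =
        raised S t (spread k (delete v p) sz⁻) (proj₂ (survives j p⁻j)) (a≤ j (proj₁ (survives j p⁻j)))
          (≤-reflexive (reflexive (≡.sym (restrict-member (delete v p) (const (1/suc k)) p⁻j))))

    drop : ∀ k S t p a → size p ≈ suc (suc k) · 1# → (∀ i → p i ≡ true → a ≤ At.heights S t i) →
           ∃[ S⁺ ] ∃[ p⁻ ] size p⁻ ≈ suc k · 1# ×
             (∀ j → p⁻ j ≡ true → a + 1/suc k ≤ At.heights S⁺ (suc t) j)
    drop k S t p a sz a≤ =
      let _ , pi            = member (suc k) p sz
          v , pv , survives = victim (At.move S t) p pi
          sz⁻               = +-cancelʳ 1# _ _ (trans (mass-delete p (const 1#) pv) (trans sz (+-comm 1# (suc k · 1#))))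
      in steer t S (spread k (delete v p) sz⁻) , delete v p , sz⁻ , spread-raises k S t p a v sz⁻ survives a≤

    -- While the set shrinks from k + 1 cups to one, the survivors gain 1/k, 1/(k - 1), ..., 1,
    -- which adds up to `H k`.
    draining : ∀ k S t p a → size p ≈ suc k · 1# → (∀ i → p i ≡ true → a ≤ At.heights S t i) →
               ∃[ S′ ] ∃[ t′ ] ∃[ i ] a + H k ≤ At.heights S′ t′ i
    draining zero S t p a sz a≤ =
      let i , pi = member zero p sz in S , t , i , ≤-respˡ-≈ (sym (+-identityʳ a)) (a≤ i pi)
    draining (suc k) S t p a sz a≤ =
      let S⁺ , p⁻ , sz⁻ , higher = drop k S t p a sz a≤
          S′ , t′ , j , reached  = draining k S⁺ (suc t) p⁻ (a + 1/suc k) sz⁻ higher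
      in S′ , t′ , j , ≤-respˡ-≈
        (trans (+-assoc a (1/suc k) (H k)) (+-congˡ (trans (+-comm (1/suc k) (H k)) (sym (H-suc k))))) reached

    -- Flooding lifts all cups to (T + 1) · δ = 1 - m · δ, and draining all m + 1 of them adds
    -- `H m`. The deficit m · δ vanishes as T grows.
    H+1≤bound : ∀ b → IsUpperBound (allHeights A) b → H m + 1# ≤ b
    H+1≤bound b h≤b = ≤-limit m λ T → forced T
      where
      forced : ∀ T → H m + 1# ≤ b + m · 1/suc (m ℕ.+ T)
      forced T with flooding T T ℕₚ.≤-refl
      ... | S , level with draining m S T (const true) (suc T · 1/suc (m ℕ.+ T)) (sum-replicate n {1#}) (λ i _ → level i)
      ...   | S′ , t′ , i , reached = begin
        H m + 1#                       ≈⟨ +-congˡ (suc·1/suc (m ℕ.+ T)) ⟨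
        H m + suc (m ℕ.+ T) · δ        ≈⟨ +-congˡ (+-congˡ (×-homo-+ δ m T)) ⟩
        H m + (δ + (m · δ + T · δ))    ≈⟨ solve 4 (λ h d k l → h :+ (d :+ (k :+ l)) := d :+ l :+ h :+ k) refl (H m) δ (m · δ) (T · δ) ⟩
        suc T · δ + H m + m · δ        ≤⟨ +-monoˡ-≤ _ (≤-trans reached (h≤b (S′ , t′ , i))) ⟩
        b + m · δ                      ∎
        where δ = 1/suc (m ℕ.+ T)

  H+1-isOptimal : IsOptimalWorstCaseBacklog allHeights (H m + 1#)
  H+1-isOptimal = (greedy , greedy≤ , H+1≤bound greedy) , H+1≤bound

  -- The invariant yields H m + 2, and H n is larger than H m by 1/n > 0.
  hybrid< : ∀ assumed A → IsHybrid assumed A → ∀ x → allHeights A x < H n + 2#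
  hybrid< assumed A hybrid x = ≤-<-trans (hybrid≤ assumed A hybrid x) (≰⇒< λ H+2≤ →
    <⇒≱ 0<1/n (transfer H+2≤
      (trans (solve 2 (λ h r → r :+ (h :+ con 1 :+ con 1) := con 0 :+ (h :+ r :+ (con 1 :+ con 1))) refl (H m) (1/suc m))
             (+-congˡ (+-congʳ (sym (H-suc m)))))))
    where
    0<1/n : 0# < 1/suc m
    0<1/n = 0≤1/suc m , λ 0≈ → 0≉1 (trans (sym (zeroʳ _)) (trans (*-congˡ 0≈) (⁻¹-inverse _ (proj₂ (0<suc·1 m) ∘ sym))))

theorem8 :
  ∀ {c ℓ₁ ℓ₂} (F : ArchimedeanOrderedField c ℓ₁ ℓ₂) →
  let open ArchimedeanOrderedField F
      open CupGames F
  in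
    ( IsOptimalWorstCaseBacklog BambooGarden.heights 2#
    × (∀ A → BambooGarden.IsHybrid A → IsSupremum (BambooGarden.heights A) 2#))
  × ( IsOptimalWorstCaseBacklog FixedRate.heights 2#
    × (∀ A → FixedRate.IsHybrid A → IsSupremum (FixedRate.heights A) 2#))
  × ( ∀ (n : ℕ) .{{_ : NonZero n}} →
      let open VariableRate n in
        (∀ assumed A → IsHybrid assumed A → ∀ x → heights A x < H n + 2#)
      × (∃[ v ] IsOptimalWorstCaseBacklog heights v
              × (∀ assumed A → IsHybrid assumed A → IsUpperBound (heights A) (v + 1#))))
theorem8 F =
    (2-isOptimal removeAll-isRemoval , hybrid-isSupremum removeAll-isRemoval)
  , (2-isOptimal removeUnit-isRemoval , hybrid-isSupremum removeUnit-isRemoval)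
  -- For `suc m` cups the optimum, left to unification, is `H m + 1#`.
  , λ { (suc m) → let open VariableRates F m in
          hybrid< , _ , H+1-isOptimal , hybrid≤ }
  where
  open Cups F
  open ConstantRates
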